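{- For every integer $n \geq 2$, the generalized $4$-connectivity of the $n$-dimensional burnt pancake graph satisfies $\kappa_4(BP_n) = n-1$.
   Context: Notation: $[n]=\{1,\dots,n\}$, $\bar{i}=-i$, and $[[n]] = [n]\cup\{\bar i : i\in[n]\}$. A signed permutation of $[n]$ is a sequence $x = x_1x_2\cdots x_n$ of elements of $[[n]]$ such that $|x_1||x_2|\cdots|x_n|$ is a permutation of $[n]$. For $1\le i\le n$, the $i$-th signed prefix reversal of $x$ is $x(i) = \bar{x}_i\bar{x}_{i-1}\cdots\bar{x}_1x_{i+1}\cdots x_n$. The $n$-dimensional burnt pancake graph $BP_n$ ($n\ge 2$) is the simple graph whose vertices are all signed permutations of $[n]$, with $x$ and $y$ adjacent if and only if $y = x(i)$ for some $i\in[n]$. Generalized connectivity: for a simple graph $G$ and $S\subseteq V(G)$, an $S$-tree is a tree $T$ in $G$ with $S\subseteq V(T)$. $S$-trees $T_1,\dots,T_r$ are internally edge disjoint if $V(T_i)\cap V(T_j)=S$ and $E(T_i)\cap E(T_j)=\emptyset$ for all $i\neq j$. $\kappa_G(S)$ denotes the maximum number of internally edge disjoint $S$-trees in $G$, and for $2\le k\le |V(G)|$, $\kappa_k(G)=\min\{\kappa_G(S) : S\subseteq V(G),\ |S|=k\}$. -}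

module Defs where

open import Data.Nat using (ℕ; _≤_; _+_)
open import Data.Fin using (Fin)
open import Data.Bool using (Bool; not)
open import Data.Product using (Σ; ∃; _×_; _,_; proj₁)
open import Data.Sum using (_⊎_)
open import Data.Empty using (⊥)
open import Data.List using (List; []; _∷_; [_]; _++_; map; reverse; take; drop; length)
open import Data.List.Membership.Propositional using (_∈_)
open import Data.List.Relation.Unary.Unique.Propositional using (Unique)
open import Data.List.Relation.Unary.Linked using (Linked)
open import Relation.Binary.PropositionalEquality using (_≡_; _≢_)

-- Simple graphs: a vertex type with propositional equality, a predicate
-- singling out the vertex set V(G), and an adjacency relation.

record Graph : Set₁ where
  field
    Vx  : Set
    InV : Vx → Set
    Adj : Vx → Vx → Set
open Graph public

-- Burnt pancake graph BP_n.
-- An element of [[n]] is (a , s) with a : Fin n standing for |.| - 1 and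
-- s = true meaning the element carries a bar (is negative).

SElt : ℕ → Set
SElt n = Fin n × Bool

negate : ∀ {n} → SElt n → SElt n
negate (a , s) = (a , not s)

SWord : ℕ → Set
SWord n = List (SElt n)

IsSignedPerm : (n : ℕ) → SWord n → Set
IsSignedPerm n x = (length x ≡ n) × Unique (map proj₁ x)

prefixRev : ∀ {n} → SWord n → ℕ → SWord n
prefixRev x i = map negate (reverse (take i x)) ++ drop i x

BP : ℕ → Graph
BP n = record
  { Vx  = SWord n
  ; InV = IsSignedPerm n
  ; Adj = λ x y → Σ ℕ λ i → (1 ≤ i) × (i ≤ n) × (y ≡ prefixRev x i)
  }

-- Subgraphs given by a vertex list and an edge list (as sets).

record Sub (V : Set) : Set where
  constructor sub
  field
    verts : List V
    edges : List (V × V)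
open Sub public

EdgeIn : ∀ {V} → Sub V → V → V → Set
EdgeIn T u v = ((u , v) ∈ edges T) ⊎ ((v , u) ∈ edges T)

data Walk {V : Set} (T : Sub V) : V → V → Set where
  here : ∀ {u} → u ∈ verts T → Walk T u u
  step : ∀ {u w v} → EdgeIn T u w → Walk T w v → Walk T u v

Connected : ∀ {V} → Sub V → Set
Connected T = ∀ u v → u ∈ verts T → v ∈ verts T → Walk T u v

HasCycle : ∀ {V} → Sub V → Set
HasCycle {V} T = Σ V λ v → Σ (List V) λ rest →
  (2 ≤ length rest) × Unique (v ∷ rest) × Linked (EdgeIn T) (v ∷ rest ++ [ v ])

Acyclic : ∀ {V} → Sub V → Set
Acyclic T = HasCycle T → ⊥

IsSubgraph : (G : Graph) → Sub (Vx G) → Set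
IsSubgraph G T =
  (∀ v → v ∈ verts T → InV G v) ×
  (∀ u v → (u , v) ∈ edges T → (u ∈ verts T) × (v ∈ verts T) × Adj G u v)

IsTreeIn : (G : Graph) → Sub (Vx G) → Set
IsTreeIn G T = IsSubgraph G T × Connected T × Acyclic T

IsSTree : (G : Graph) → List (Vx G) → Sub (Vx G) → Set
IsSTree G S T = IsTreeIn G T × (∀ v → v ∈ S → v ∈ verts T)

IntEdgeDisjoint : ∀ {V} → List V → Sub V → Sub V → Set
IntEdgeDisjoint S T₁ T₂ =
  (∀ v → v ∈ verts T₁ → v ∈ verts T₂ → v ∈ S) ×
  (∀ u v → EdgeIn T₁ u v → EdgeIn T₂ u v → ⊥)

Family : (G : Graph) → List (Vx G) → ℕ → Set
Family G S r = Σ (Fin r → Sub (Vx G)) λ T →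
  (∀ i → IsSTree G S (T i)) ×
  (∀ i j → i ≢ j → IntEdgeDisjoint S (T i) (T j))

KappaS : (G : Graph) → List (Vx G) → ℕ → Set
KappaS G S r = Family G S r × (∀ r' → Family G S r' → r' ≤ r)

IsKSubset : (G : Graph) → ℕ → List (Vx G) → Set
IsKSubset G k S = Unique S × (length S ≡ k) × (∀ v → v ∈ S → InV G v)

Kappa : ℕ → Graph → ℕ → Set
Kappa k G m =
  (∀ S → IsKSubset G k S → Σ ℕ λ r → KappaS G S r × (m ≤ r)) ×
  (Σ (List (Vx G)) λ S → IsKSubset G k S × KappaS G S m)

{-# OPTIONS --safe #-}
-- Upper bound. The trees use disjoint sets of edges at a vertex of S, so there are at most n of
-- them. If u and v in S are adjacent, a tree using the edge uv also needs another edge at u or at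
-- v, so there are at most n - 1. Whether n trees exist is decidable, BP n being finite, and this
-- determines the maximum once n - 1 trees are known to exist.
--
-- Lower bound. Write |x₁| and |xₙ| for the first and last symbol of x without sign, and call the
-- words with a given last symbol a cluster; it is connected. The trees are labelled by the symbols
-- j ≠ p for a suitable p, and one of the two clusters ending in ± j that avoids S becomes the hub of
-- the tree j. Any other word x has label |x₁|, or |xₙ| if |x₁| = p. It reaches the hub of its label
-- inside that label by reversing the whole word, after a reversal of length 1 if the sign is wrong;
-- if |x₁| = p this is done twice. The reversals of s of length < n keep the last symbol and bring every
-- symbol other than |sₙ| to the front, so s has a neighbour of every label. Paths may run through
-- vertices of S, so the only obstacle is an edge of a cluster with both ends s, t in S and of
-- different labels, which only one end may use. The other end, say s, then enters the tree of t by
-- reversing the whole word, into a cluster that has no other use and is given the label of t.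
module Submission where
open import Defs
open import Data.Nat using (ℕ; zero; suc; _≤_; _<_; _∸_; _+_; z≤n; s≤s)
import Data.Nat.Properties as ℕₚ
open import Data.Fin using (Fin; zero; suc; toℕ; fromℕ<; punchIn; punchOut)
import Data.Fin.Properties as Finₚ
open import Data.Bool using (Bool; true; false)
import Data.Bool.Properties as Boolₚ
open import Data.Maybe using (Maybe; just; nothing)
open import Data.Product using (Σ; ∃; ∃-syntax; _×_; _,_; proj₁; proj₂; swap)
open import Data.Product.Properties using (≡-dec)
open import Data.Sum using (_⊎_; inj₁; inj₂; [_,_]′)
open import Data.Empty using (⊥; ⊥-elim)
open import Data.Unit using (⊤)
open import Data.List using (List; []; _∷_; [_]; _++_; map; reverse; take; drop; length; lookup; cartesianProduct; cartesianProductWith; allFin; tabulate; initLast; _∷ʳ′_)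
import Data.List.Properties as Listₚ
open import Data.Vec using (Vec; []; _∷_)
import Data.Vec as Vec
import Data.Vec.Properties as Vecₚ
open import Data.List.Membership.Propositional using (_∈_; _∉_; lose) renaming (find to ∈-find)
import Data.List.Membership.Propositional.Properties as ∈ₚ
import Data.List.Membership.DecPropositional as Dec∈
open import Data.List.Relation.Unary.Any using (here; there; index)
import Data.List.Relation.Unary.Any as Any
import Data.List.Relation.Unary.Any.Properties as Anyₚ
open import Data.List.Relation.Unary.All using (All; []; _∷_)
import Data.List.Relation.Unary.All as All
import Data.List.Relation.Unary.All.Properties as Allₚ
open import Data.List.Relation.Unary.AllPairs using ([]; _∷_)
open import Data.List.Relation.Unary.Unique.Propositional using (Unique)
import Data.List.Relation.Unary.Unique.Propositional.Properties as Uniqueₚ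
open import Data.List.Relation.Unary.Unique.DecPropositional using (unique?)
open import Data.List.Relation.Unary.Linked using (Linked; []; [-]; _∷_)
import Data.List.Relation.Unary.Linked as Linked
open import Data.List.Relation.Binary.Permutation.Propositional using (_↭_; ↭-sym; ↭⇒↭ₛ)
import Data.List.Relation.Binary.Permutation.Propositional.Properties as ↭ₚ
import Data.List.Relation.Binary.Permutation.Setoid.Properties as ↭ₛₚ
open import Data.List.Relation.Binary.Subset.Propositional using (_⊆_)
open import Function using (_∘_; id; case_of_)
open import Function.Definitions using (Injective)
open import Relation.Binary.Definitions using (DecidableEquality)
open import Relation.Binary.Construct.Closure.ReflexiveTransitive using (Star; ε; _◅_; _◅◅_; gmap)
open import Relation.Binary.PropositionalEquality using (_≡_; _≢_; refl; sym; trans; cong; cong₂; subst; subst₂; setoid; module ≡-Reasoning)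
open import Relation.Nullary using (¬_; Dec; yes; no)
open import Relation.Nullary.Decidable using (_×-dec_; _⊎-dec_; ¬?; map′)

-- Every edge of a tree is directed towards the root and its head carries the label of the tree. Two
-- trees can therefore share an edge only by using it in opposite directions, and then both its ends
-- lie in S; this is why only edges inside S need care.
--
-- A symbol both of whose clusters meet S leaves no cluster for a hub. Giving up the label p absorbs
-- one such symbol, and giving up one label is also what the bound n - 1 allows. Four vertices can
-- produce at most two such symbols. With two of them, one still needs a tree and must borrow a
-- cluster of a third symbol, so that case needs n at least 3; for n = 2 a single tree is enough and
-- connectedness provides it.
--
-- When no symbol is forced to be p, the choice of p is a resource. It is spent on rivals whose
-- first symbols collide with the last symbols of S: if p is the first symbol of a word, that symbol
-- needs no hub, or the word takes its label from its last symbol instead.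
--
-- The degree leaves n - 1 and n as possible maxima for a given S. The argument never says which one
-- occurs, and a finite search decides it.

module Growth {V : Set} (_≟_ : DecidableEquality V) (R : V → V → Set) where
  open Dec∈ _≟_ using (_∈?_)

  -- Growth leaf by leaf turns connectedness and acyclicity into inductions. `R` stays directed
  -- because the label of the parent will tell which tree owns an edge.
  data Grown (r : V) : List V → List (V × V) → Set where
    root : Grown r [ r ] []
    leaf : ∀ {vs es x y} → Grown r vs es → y ∈ vs → x ∉ vs → R x y →
           Grown r (x ∷ vs) ((x , y) ∷ es)

  root∈ : ∀ {r vs es} → Grown r vs es → r ∈ vs
  root∈ root           = here refl
  root∈ (leaf g _ _ _) = there (root∈ g)

  -- The path is laid from the tree backwards, so each new vertex hangs on one already present.
  -- Vertices met again are skipped; the path need be neither simple nor disjoint from the tree.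
  attach : ∀ {r vs es x v} → Grown r vs es → v ∈ vs → Star R x v →
           ∃[ vs' ] ∃[ es' ] (Grown r vs' es' × vs ⊆ vs' × x ∈ vs')
  attach g v∈ ε = _ , _ , g , id , v∈
  attach {x = x} g v∈ (Rxy ◅ p) with attach g v∈ p
  ... | vs , es , g' , vs⊆ , y∈ with x ∈? vs
  ... | yes x∈ = vs , es , g' , vs⊆ , x∈
  ... | no x∉  = _ , _ , leaf g' y∈ x∉ Rxy , there ∘ vs⊆ , here refl

  attachAll : ∀ {r} (S : List V) → (∀ s → s ∈ S → Star R s r) →
              ∃[ vs ] ∃[ es ] (Grown r vs es × S ⊆ vs)
  attachAll []      paths = _ , _ , root , λ ()
  attachAll (s ∷ S) paths with attachAll S (λ t t∈ → paths t (there t∈))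
  ... | vs , es , g , S⊆ with attach g (root∈ g) (paths s (here refl))
  ... | vs' , es' , g' , vs⊆ , s∈ =
    vs' , es' , g' , λ { (here refl) → s∈ ; (there t∈) → vs⊆ (S⊆ t∈) }

  edge⇒R : ∀ {r vs es x y} → Grown r vs es → (x , y) ∈ es → x ∈ vs × y ∈ vs × R x y
  edge⇒R (leaf g y∈ _ Rxy) (here refl) = here refl , there y∈ , Rxy
  edge⇒R (leaf g _ _ _) (there e∈) with edge⇒R g e∈
  ... | x∈ , y∈ , Rxy = there x∈ , there y∈ , Rxy

  vertex⇒ : ∀ {r vs es} → Grown r vs es → ∀ {x} → x ∈ vs → x ≡ r ⊎ ∃[ y ] R x y
  vertex⇒ root               (here refl) = inj₁ refl
  vertex⇒ (leaf _ _ _ Rxy)   (here refl) = inj₂ (_ , Rxy)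
  vertex⇒ (leaf g _ _ _)     (there x∈)  = vertex⇒ g x∈

  grown-unique : ∀ {r vs es} → Grown r vs es → Unique vs
  grown-unique root            = [] ∷ []
  grown-unique (leaf g _ x∉ _) = Allₚ.¬Any⇒All¬ _ x∉ ∷ grown-unique g

  -- The vertices can be recovered from the edges, so a search for trees may range over edge lists
  -- alone.
  grown-verts : ∀ {r vs es} → Grown r vs es → vs ≡ map proj₁ es ++ [ r ]
  grown-verts root           = refl
  grown-verts (leaf g _ _ _) = cong (_ ∷_) (grown-verts g)

-- Grown subgraphs are trees

module _ {V : Set} where

  edge-sym : ∀ {T : Sub V} {u v} → EdgeIn T u v → EdgeIn T v u
  edge-sym (inj₁ e) = inj₂ e
  edge-sym (inj₂ e) = inj₁ e

  walk-mono : ∀ {T T' : Sub V} → verts T ⊆ verts T' → edges T ⊆ edges T' →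
              ∀ {u v} → Walk T u v → Walk T' u v
  walk-mono vs⊆ es⊆ (here u∈)         = here (vs⊆ u∈)
  walk-mono vs⊆ es⊆ (step (inj₁ e) w) = step (inj₁ (es⊆ e)) (walk-mono vs⊆ es⊆ w)
  walk-mono vs⊆ es⊆ (step (inj₂ e) w) = step (inj₂ (es⊆ e)) (walk-mono vs⊆ es⊆ w)

  walk-snoc : ∀ {T : Sub V} {u v w} → Walk T u v → EdgeIn T v w → w ∈ verts T → Walk T u w
  walk-snoc (here _)   e w∈ = step e (here w∈)
  walk-snoc (step e p) f w∈ = step e (walk-snoc p f w∈)

  module _ (_≟_ : DecidableEquality V) (R : V → V → Set) where
    open Growth _≟_ R
    open Dec∈ _≟_ using (_∈?_)

    grown-connected : ∀ {r vs es} → Grown r vs es → Connected (sub vs es)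
    grown-connected root u v (here refl) (here refl) = here (here refl)
    grown-connected (leaf g y∈ x∉ Rxy) u v (here refl) (here refl) = here (here refl)
    grown-connected (leaf g y∈ x∉ Rxy) u v (here refl) (there v∈) =
      step (inj₁ (here refl)) (walk-mono there there (grown-connected g _ v y∈ v∈))
    grown-connected (leaf g y∈ x∉ Rxy) u v (there u∈) (here refl) =
      walk-snoc (walk-mono there there (grown-connected g u _ u∈ y∈)) (inj₂ (here refl)) (here refl)
    grown-connected (leaf g y∈ x∉ Rxy) u v (there u∈) (there v∈) =
      walk-mono there there (grown-connected g u v u∈ v∈)

    private
      edge-verts : ∀ {r vs es u v} → Grown r vs es → EdgeIn (sub vs es) u v → u ∈ vs × v ∈ vs
      edge-verts g (inj₁ e) = let u∈ , v∈ , _ = edge⇒R g e in u∈ , v∈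
      edge-verts g (inj₂ e) = let v∈ , u∈ , _ = edge⇒R g e in u∈ , v∈

      module Leaf {r x y : V} {vs : List V} {es : List (V × V)} (g : Grown r vs es) (x∉ : x ∉ vs) where

        E E' : V → V → Set
        E  = EdgeIn (sub vs es)
        E' = EdgeIn (sub (x ∷ vs) ((x , y) ∷ es))

        -- Old edges have both ends in `vs`, so the fresh leaf `x` meets none of them.
        onlyʳ : ∀ {u} → E' x u → y ∈ vs → u ≡ y
        onlyʳ (inj₁ (here refl)) y∈ = refl
        onlyʳ (inj₂ (here refl)) y∈ = refl
        onlyʳ (inj₁ (there e))   y∈ = ⊥-elim (x∉ (proj₁ (edge-verts g (inj₁ e))))
        onlyʳ (inj₂ (there e))   y∈ = ⊥-elim (x∉ (proj₁ (edge-verts g (inj₂ e))))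

        onlyˡ : ∀ {u} → E' u x → y ∈ vs → u ≡ y
        onlyˡ e y∈ = onlyʳ (edge-sym {T = sub (x ∷ vs) ((x , y) ∷ es)} e) y∈

        old : ∀ {u v} → u ≢ x → v ≢ x → E' u v → E u v
        old u≢ v≢ (inj₁ (here refl)) = ⊥-elim (u≢ refl)
        old u≢ v≢ (inj₂ (here refl)) = ⊥-elim (v≢ refl)
        old u≢ v≢ (inj₁ (there e))   = inj₁ e
        old u≢ v≢ (inj₂ (there e))   = inj₂ e

        linked-old : ∀ {l} → x ∉ l → Linked E' l → Linked E l
        linked-old x∉l []      = []
        linked-old x∉l [-]     = [-]
        linked-old x∉l (e ∷ L) =
          old (λ { refl → x∉l (here refl) }) (λ { refl → x∉l (there (here refl)) }) e
          ∷ linked-old (x∉l ∘ there) L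

        last-edge : ∀ {a} l {c} → Linked E' (a ∷ l ++ [ c ]) → ∃[ b ] (b ∈ (a ∷ l) × E' b c)
        last-edge []      (e ∷ _) = _ , here refl , e
        last-edge (b ∷ l) (_ ∷ L) = let d , d∈ , e = last-edge l L in d , there d∈ , e

        -- Predecessor and successor of the leaf would both be `y`, so a vertex would repeat. The
        -- disjunction excludes walking to the leaf and straight back: at the base point of a cycle
        -- `a` and `c` coincide and the length is needed, one step later they differ.
        interior : ∀ {a} l {c} → y ∈ vs → x ∈ l → x ≢ a → a ∉ l → a ≢ c ⊎ 2 ≤ length l → Unique l →
                   c ∉ l → Linked E' (a ∷ l ++ [ c ]) → ⊥
        interior (b ∷ []) y∈ (here refl) x≢a a∉ (inj₁ a≢c) U c∉ (e ∷ e' ∷ _) =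
          a≢c (trans (onlyˡ e y∈) (sym (onlyʳ e' y∈)))
        interior (b ∷ []) y∈ (here refl) x≢a a∉ (inj₂ (s≤s ())) U c∉ (e ∷ e' ∷ _)
        interior (b ∷ d ∷ l) y∈ (here refl) x≢a a∉ _ U c∉ (e ∷ e' ∷ _) =
          a∉ (there (here (trans (onlyˡ e y∈) (sym (onlyʳ e' y∈)))))
        interior (b ∷ l) y∈ (there x∈) x≢a a∉ _ (b∉ ∷ U) c∉ (_ ∷ L) =
          interior l y∈ x∈ (λ { refl → Allₚ.All¬⇒¬Any b∉ x∈ }) (Allₚ.All¬⇒¬Any b∉)
                   (inj₁ (λ { refl → c∉ (here refl) })) U (c∉ ∘ there) L

    grown-acyclic : ∀ {r vs es} → Grown r vs es → Acyclic (sub vs es)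
    grown-acyclic root (v , a ∷ l , _ , _ , (inj₁ () ∷ _))
    grown-acyclic root (v , a ∷ l , _ , _ , (inj₂ () ∷ _))
    grown-acyclic (leaf {x = x} g y∈ x∉ _) (v , a ∷ [] , s≤s () , _ , _)
    grown-acyclic (leaf {x = x} g y∈ x∉ _) (v , l@(a ∷ b ∷ l') , le , U@(v∉ ∷ Ul@(a∉ ∷ _)) , L@(e ∷ _ ∷ L'))
      with v ≟ x
    -- With the leaf as base point, the first and the closing edge both lead to `y`, so `a` would
    -- recur among the later vertices.
    ... | yes refl = let d , d∈ , e' = Leaf.last-edge g x∉ l' L' in
          Allₚ.All¬⇒¬Any a∉ (subst (_∈ (b ∷ l')) (trans (Leaf.onlyˡ g x∉ e' y∈) (sym (Leaf.onlyʳ g x∉ e y∈))) d∈)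
    ... | no v≢x with x ∈? l
    ...   | yes x∈ = Leaf.interior g x∉ l y∈ x∈ (v≢x ∘ sym) (Allₚ.All¬⇒¬Any v∉) (inj₂ le) Ul (Allₚ.All¬⇒¬Any v∉) L
    ...   | no x∉l = grown-acyclic g (v , l , le , U , Leaf.linked-old g x∉ x∉cycle L)
      where
      x∉cycle : x ∉ v ∷ l ++ [ v ]
      x∉cycle (here refl) = v≢x refl
      x∉cycle (there x∈) with ∈ₚ.∈-++⁻ l x∈
      ... | inj₁ x∈l         = x∉l x∈l
      ... | inj₂ (here refl) = v≢x refl

-- Counting and finite enumeration

unique-lookup-injective : ∀ {A : Set} {xs : List A} → Unique xs → ∀ i j → lookup xs i ≡ lookup xs j → i ≡ j
unique-lookup-injective (_ ∷ _)  zero    zero    _  = refl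
unique-lookup-injective (x∉ ∷ _) zero    (suc j) eq = ⊥-elim (All.lookup x∉ (∈ₚ.∈-lookup j) eq)
unique-lookup-injective (x∉ ∷ _) (suc i) zero    eq = ⊥-elim (All.lookup x∉ (∈ₚ.∈-lookup i) (sym eq))
unique-lookup-injective (_ ∷ u)  (suc i) (suc j) eq = cong suc (unique-lookup-injective u i j eq)

index-injective : ∀ {A : Set} {x y : A} {xs} (p : x ∈ xs) (q : y ∈ xs) → index p ≡ index q → x ≡ y
index-injective {xs = xs} p q eq =
  trans (Anyₚ.lookup-index p) (trans (cong (lookup xs) eq) (sym (Anyₚ.lookup-index q)))

unique-⊆-length : ∀ {A : Set} {xs ys : List A} → Unique xs → xs ⊆ ys → length xs ≤ length ys
unique-⊆-length {xs = xs} {ys} u xs⊆ys = Finₚ.injective⇒≤ {f = f} f-injective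
  where
  f : Fin (length xs) → Fin (length ys)
  f i = index (xs⊆ys (∈ₚ.∈-lookup {xs = xs} i))
  f-injective : Injective _≡_ _≡_ f
  f-injective {i} {j} eq = unique-lookup-injective u i j
    (index-injective (xs⊆ys (∈ₚ.∈-lookup {xs = xs} i)) (xs⊆ys (∈ₚ.∈-lookup {xs = xs} j)) eq)

module _ {A : Set} where

  vecs : List A → ∀ r → List (Vec A r)
  vecs as zero    = [ [] ]
  vecs as (suc r) = cartesianProductWith _∷_ as (vecs as r)

  ∈-vecs : ∀ {as r} (v : Vec A r) → (∀ i → Vec.lookup v i ∈ as) → v ∈ vecs as r
  ∈-vecs []      _  = here refl
  ∈-vecs (a ∷ v) a∈ = ∈ₚ.∈-cartesianProductWith⁺ _∷_ (a∈ zero) (∈-vecs v (λ i → a∈ (suc i)))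

  listsUpTo : List A → ℕ → List (List A)
  listsUpTo as zero    = [ [] ]
  listsUpTo as (suc m) = [] ∷ cartesianProductWith _∷_ as (listsUpTo as m)

  ∈-listsUpTo : ∀ {as m} l → l ⊆ as → length l ≤ m → l ∈ listsUpTo as m
  ∈-listsUpTo {m = zero}  []      _  _        = here refl
  ∈-listsUpTo {m = suc m} []      _  _        = here refl
  ∈-listsUpTo {m = suc m} (a ∷ l) l⊆ (s≤s le) =
    there (∈ₚ.∈-cartesianProductWith⁺ _∷_ (l⊆ (here refl)) (∈-listsUpTo l (l⊆ ∘ there) le))

-- Only membership in S enters the notion of a family; all later arguments "by symmetry" reorder S
-- through this.
family-⊆ : ∀ {G r S S'} → S ⊆ S' → S' ⊆ S → Family G S r → Family G S' r
family-⊆ S⊆ ⊇S (T , tree , disj) =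
  T , (λ i → proj₁ (tree i) , λ v v∈ → proj₂ (tree i) v (⊇S v∈)) ,
  λ i j i≢j → (λ v p q → S⊆ (proj₁ (disj i j i≢j) v p q)) , proj₂ (disj i j i≢j)

-- Families of S-trees and the decision whether r of them exist

module Families (G : Graph) (_≟_ : DecidableEquality (Vx G))
                (adj-sym : ∀ {x y} → InV G x → Adj G x y → Adj G y x) where
  private V = Vx G
  open Dec∈ _≟_ using (_∈?_)

  -- Asking `InV` of the tail is enough, since every vertex of a grown tree is its root or a tail.
  Step : V → V → Set
  Step x y = InV G x × Adj G x y

  module GS = Growth _≟_ Step

  module _ {R : V → V → Set} (R⇒Step : ∀ {x y} → R x y → Step x y) where
    module GR = Growth _≟_ R

    grown-map : ∀ {r vs es} → GR.Grown r vs es → GS.Grown r vs es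
    grown-map GR.root               = GS.root
    grown-map (GR.leaf g y∈ x∉ Rxy) = GS.leaf (grown-map g) y∈ x∉ (R⇒Step Rxy)

  grown-inV : ∀ {r vs es} → InV G r → GS.Grown r vs es → ∀ v → v ∈ vs → InV G v
  grown-inV r∈V g v v∈ with GS.vertex⇒ g v∈
  ... | inj₁ refl        = r∈V
  ... | inj₂ (_ , v∈V , _) = v∈V

  grown-STree : ∀ {S r vs es} → InV G r → GS.Grown r vs es → S ⊆ vs → IsSTree G S (sub vs es)
  grown-STree r∈V g S⊆ =
    ((grown-inV r∈V g , λ u v e → let u∈ , v∈ , _ , a = GS.edge⇒R g e in u∈ , v∈ , a) ,
     grown-connected _≟_ Step g , grown-acyclic _≟_ Step g) ,
    λ _ → S⊆

  module _ {S : List V} {T : Sub V} (st : IsSTree G S T) where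
    private
      tree = proj₁ st

    edge-verts : ∀ {u v} → EdgeIn T u v → u ∈ verts T × v ∈ verts T
    edge-verts (inj₁ e) = let u∈ , v∈ , _ = proj₂ (proj₁ tree) _ _ e in u∈ , v∈
    edge-verts (inj₂ e) = let v∈ , u∈ , _ = proj₂ (proj₁ tree) _ _ e in u∈ , v∈

    edge-step : ∀ {u v} → EdgeIn T u v → Step u v
    edge-step (inj₁ e) = let u∈ , v∈ , a = proj₂ (proj₁ tree) _ _ e in proj₁ (proj₁ tree) _ u∈ , a
    edge-step (inj₂ e) = let v∈ , u∈ , a = proj₂ (proj₁ tree) _ _ e in
      proj₁ (proj₁ tree) _ u∈ , adj-sym (proj₁ (proj₁ tree) _ v∈) a

    S-walk : ∀ {u v} → u ∈ S → v ∈ S → Walk T u v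
    S-walk u∈ v∈ = proj₁ (proj₂ tree) _ _ (proj₂ st _ u∈) (proj₂ st _ v∈)

  walk⇒star : ∀ {T : Sub V} {u v} → Walk T u v → Star (EdgeIn T) u v
  walk⇒star (here _)   = ε
  walk⇒star (step e w) = e ◅ walk⇒star w

  module Decide (InV? : ∀ x → Dec (InV G x)) (Adj? : ∀ x y → Dec (Adj G x y))
                (all : List V) (all-complete : ∀ {x} → InV G x → x ∈ all)
                (r₀ : V) (S : List V) where

    private S⁺ = r₀ ∷ S

    vertsOf : List (V × V) → List V
    vertsOf es = map proj₁ es ++ [ r₀ ]

    toSub : List (V × V) → Sub V
    toSub es = sub (vertsOf es) es

    -- Edges are pairs (child , parent), the last leaf attached coming first.
    Valid : List (V × V) → Set
    Valid es = GS.Grown r₀ (vertsOf es) es × All (_∈ vertsOf es) S⁺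

    grown? : ∀ es → Dec (GS.Grown r₀ (vertsOf es) es)
    grown? []             = yes GS.root
    grown? ((x , y) ∷ es) =
      map′ (λ { (g , y∈ , x∉ , s) → GS.leaf g y∈ x∉ s }) (λ { (GS.leaf g y∈ x∉ s) → g , y∈ , x∉ , s })
           (grown? es ×-dec (y ∈? vertsOf es ×-dec (¬? (x ∈? vertsOf es) ×-dec (InV? x ×-dec Adj? x y))))

    valid? : ∀ es → Dec (Valid es)
    valid? es = grown? es ×-dec All.all? (_∈? vertsOf es) S⁺

    _≟ₑ_ : DecidableEquality (V × V)
    _≟ₑ_ = ≡-dec _≟_ _≟_

    open Dec∈ _≟ₑ_ renaming (_∈?_ to _∈ₑ?_) using ()

    Disj : List (V × V) → List (V × V) → Set
    Disj es fs = All (λ v → v ∉ vertsOf fs ⊎ v ∈ S⁺) (vertsOf es) ×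
                 All (λ e → e ∉ fs × swap e ∉ fs) es

    disj? : ∀ es fs → Dec (Disj es fs)
    disj? es fs = All.all? (λ v → ¬? (v ∈? vertsOf fs) ⊎-dec (v ∈? S⁺)) (vertsOf es) ×-dec
                  All.all? (λ e → ¬? (e ∈ₑ? fs) ×-dec ¬? (swap e ∈ₑ? fs)) es

    disj⇒ : ∀ {es fs} → Disj es fs → IntEdgeDisjoint S⁺ (toSub es) (toSub fs)
    disj⇒ {es} {fs} (dv , de) = vs , ed
      where
      vs : ∀ v → v ∈ vertsOf es → v ∈ vertsOf fs → v ∈ S⁺
      vs v v∈ v∈' = [ (λ v∉ → ⊥-elim (v∉ v∈')) , id ]′ (All.lookup dv v∈)
      ed : ∀ u v → EdgeIn (toSub es) u v → EdgeIn (toSub fs) u v → ⊥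
      ed u v (inj₁ e) (inj₁ f) = proj₁ (All.lookup de e) f
      ed u v (inj₁ e) (inj₂ f) = proj₂ (All.lookup de e) f
      ed u v (inj₂ e) (inj₁ f) = proj₂ (All.lookup de e) f
      ed u v (inj₂ e) (inj₂ f) = proj₁ (All.lookup de e) f

    ⇒disj : ∀ {es fs} → IntEdgeDisjoint S⁺ (toSub es) (toSub fs) → Disj es fs
    ⇒disj {es} {fs} (dv , de) = All.tabulate vs ,
      All.tabulate λ e∈ → (λ f → de _ _ (inj₁ e∈) (inj₁ f)) , (λ f → de _ _ (inj₁ e∈) (inj₂ f))
      where
      vs : ∀ {v} → v ∈ vertsOf es → v ∉ vertsOf fs ⊎ v ∈ S⁺
      vs {v} v∈ with v ∈? vertsOf fs
      ... | yes v∈' = inj₂ (dv v v∈ v∈')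
      ... | no v∉   = inj₁ v∉

    Certificate : ∀ {r} → Vec (List (V × V)) r → Set
    Certificate v = (∀ i → Valid (Vec.lookup v i)) ×
                    (∀ i j → i ≡ j ⊎ Disj (Vec.lookup v i) (Vec.lookup v j))

    certificate? : ∀ {r} (v : Vec (List (V × V)) r) → Dec (Certificate v)
    certificate? v =
      Finₚ.all? (λ i → valid? _) ×-dec
      Finₚ.all? (λ i → Finₚ.all? (λ j → (i Finₚ.≟ j) ⊎-dec disj? _ _))

    certificate⇒family : InV G r₀ → ∀ {r} {v : Vec (List (V × V)) r} → Certificate v → Family G S⁺ r
    certificate⇒family r₀∈V {v = v} (val , dis) =
      (toSub ∘ Vec.lookup v) ,
      (λ i → grown-STree r₀∈V (proj₁ (val i)) (All.lookup (proj₂ (val i)))) ,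
      λ i j i≢j → [ (λ eq → ⊥-elim (i≢j eq)) , disj⇒ ]′ (dis i j)

    private
      pairs = cartesianProduct all all
      candidates = listsUpTo pairs (length all)

    -- A grown tree has at most as many edges as vertices, and its vertices are distinct members of
    -- `all`; this bounds the search.
    candidate : InV G r₀ → ∀ {es} → Valid es → es ∈ candidates
    candidate r₀∈V {es} (g , _) = ∈-listsUpTo es pairs∈
      (ℕₚ.≤-trans es≤vs (unique-⊆-length (GS.grown-unique g) (all-complete ∘ grown-inV r₀∈V g _)))
      where
      pairs∈ : es ⊆ pairs
      pairs∈ e∈ = let u∈ , v∈ , _ = GS.edge⇒R g e∈ in
        ∈ₚ.∈-cartesianProduct⁺ (all-complete (grown-inV r₀∈V g _ u∈)) (all-complete (grown-inV r₀∈V g _ v∈))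
      es≤vs : length es ≤ length (vertsOf es)
      es≤vs = subst (length es ≤_) (sym (Listₚ.length-++ (map proj₁ es)))
                (subst (λ k → length es ≤ k + 1) (sym (Listₚ.length-map proj₁ es)) (ℕₚ.m≤m+n _ 1))

    -- An arbitrary tree is not literally a grown one, so it is replaced by a tree regrown from its
    -- own walks between `S⁺` and `r₀`. This uses only vertices and edges of the original, so
    -- disjointness survives.
    family⇒certificate : ∀ {r} → Family G S⁺ r → Σ (Vec (List (V × V)) r) Certificate
    family⇒certificate {r} (T , st , dis) = Vec.tabulate es ,
      (λ i → subst Valid (sym (Vecₚ.lookup∘tabulate es i)) (valid i)) ,
      λ i j → subst₂ (λ a b → i ≡ j ⊎ Disj a b) (sym (Vecₚ.lookup∘tabulate es i))
                     (sym (Vecₚ.lookup∘tabulate es j)) (disjoint i j)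
      where
      module GE i = Growth _≟_ (EdgeIn (T i))
      grown : ∀ i → ∃[ vs ] ∃[ es ] (GE.Grown i r₀ vs es × S⁺ ⊆ vs)
      grown i = GE.attachAll i S⁺ (λ s s∈ → walk⇒star {T = T i} (S-walk (st i) s∈ (here refl)))
      es : Fin r → List (V × V)
      es i = proj₁ (proj₂ (grown i))
      grown' : ∀ i → GE.Grown i r₀ (vertsOf (es i)) (es i)
      grown' i = let _ , _ , g , _ = grown i in
        subst (λ vs → GE.Grown i r₀ vs (es i)) (GE.grown-verts i g) g
      valid : ∀ i → Valid (es i)
      valid i = grown-map (edge-step (st i)) (grown' i) ,
        All.tabulate (λ {s} s∈ → let _ , _ , g , S⊆ = grown i in subst (λ vs → s ∈ vs) (GE.grown-verts i g) (S⊆ s∈))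
      verts⊆ : ∀ i {v} → v ∈ vertsOf (es i) → v ∈ verts (T i)
      verts⊆ i v∈ with GE.vertex⇒ i (grown' i) v∈
      ... | inj₁ refl    = proj₂ (st i) r₀ (here refl)
      ... | inj₂ (_ , e) = proj₁ (edge-verts (st i) e)
      edges⊆ : ∀ i {u v} → EdgeIn (toSub (es i)) u v → EdgeIn (T i) u v
      edges⊆ i (inj₁ e) = proj₂ (proj₂ (GE.edge⇒R i (grown' i) e))
      edges⊆ i (inj₂ e) = edge-sym {T = T i} (proj₂ (proj₂ (GE.edge⇒R i (grown' i) e)))
      disjoint : ∀ i j → i ≡ j ⊎ Disj (es i) (es j)
      disjoint i j with i Finₚ.≟ j
      ... | yes i≡j = inj₁ i≡j
      ... | no i≢j  = inj₂ (⇒disj ((λ v p q → proj₁ (dis i j i≢j) v (verts⊆ i p) (verts⊆ j q)) ,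
                                   λ u v p q → proj₂ (dis i j i≢j) u v (edges⊆ i p) (edges⊆ j q)))

    family? : InV G r₀ → ∀ r → Dec (Family G S⁺ r)
    family? r₀∈V r with Any.any? certificate? (vecs candidates r)
    ... | yes a = yes (certificate⇒family r₀∈V {v = proj₁ (Any.satisfied a)} (proj₂ (Any.satisfied a)))
    ... | no ¬a = no λ F → let v , c = family⇒certificate F in
      ¬a (lose (∈-vecs v (λ i → candidate r₀∈V (proj₁ c i))) c)

-- Upper bounds from the degree

module Degree (G : Graph) (_≟_ : DecidableEquality (Vx G))
              (adj-sym : ∀ {x y} → InV G x → Adj G x y → Adj G y x)
              {d : ℕ} (nbr : Vx G → Fin d → Vx G)
              (nbr-complete : ∀ {x y} → InV G x → Adj G x y → ∃[ k ] y ≡ nbr x k) where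
  private V = Vx G
  open Families G _≟_ adj-sym

  first-edge : ∀ {T : Sub V} {u v} → u ≢ v → Walk T u v → ∃[ x ] EdgeIn T u x
  first-edge u≢v (here _)   = ⊥-elim (u≢v refl)
  first-edge u≢v (step e _) = _ , e

  -- If the first step leads to `v`, the rest is a walk from `v` to `w` and the same dichotomy
  -- applies with `u` and `v` exchanged.
  exit : ∀ {T : Sub V} {u v w} → u ≢ w → v ≢ w → Walk T u w →
         (∃[ x ] (x ≢ v × EdgeIn T u x)) ⊎ ((∃[ x ] (x ≢ u × EdgeIn T v x)) × EdgeIn T u v)
  exit u≢w v≢w (here _) = ⊥-elim (u≢w refl)
  exit {v = v} u≢w v≢w (step {w = x} e p) with x ≟ v
  ... | no x≢v   = inj₁ (x , x≢v , e)
  ... | yes refl with exit v≢w u≢w p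
  ...   | inj₁ f        = inj₂ (f , e)
  ...   | inj₂ (f , _)  = inj₁ f

  module _ {S : List V} {r : ℕ} (F : Family G S r) where
    private
      T = proj₁ F
      st = proj₁ (proj₂ F)
      disj = proj₂ (proj₂ F)

    module Ends {s : V} (end : ∀ i → ∃[ x ] EdgeIn (T i) s x) where

      position : ∀ i → ∃[ k ] proj₁ (end i) ≡ nbr s k
      position i = let s∈V , a = edge-step (st i) (proj₂ (end i)) in nbr-complete s∈V a

      -- Edge-disjoint trees leave `s` along different edges, hence to different ones of its `d`
      -- neighbour positions.
      position-injective : Injective _≡_ _≡_ (proj₁ ∘ position)
      position-injective {i} {j} eq with i Finₚ.≟ j
      ... | yes i≡j = i≡j
      ... | no i≢j  = ⊥-elim (proj₂ (disj i j i≢j) s _ (proj₂ (end i))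
              (subst (EdgeIn (T j) s) (trans (proj₂ (position j)) (trans (cong (nbr s) (sym eq)) (sym (proj₂ (position i)))))
                     (proj₂ (end j))))

    degree-bound : ∀ {s s'} → s ∈ S → s' ∈ S → s ≢ s' → r ≤ d
    degree-bound s∈ s'∈ s≢s' = Finₚ.injective⇒≤ (Ends.position-injective λ i →
      first-edge {T = T i} s≢s' (S-walk (st i) s∈ s'∈))

  module _ {S : List V} {r : ℕ} (F : Family G S r) {u v w : V} (u∈ : u ∈ S) (v∈ : v ∈ S) (w∈ : w ∈ S)
           (u≢w : u ≢ w) (v≢w : v ≢ w) {k l : Fin d} (uv : nbr u k ≡ v) (vu : nbr v l ≡ u) where
    private
      T = proj₁ F
      st = proj₁ (proj₂ F)
      disj = proj₂ (proj₂ F)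

    -- The position `h` of the neighbour `t` is never taken, so removing it leaves room for `d'`
    -- trees only.
    avoiding-bound : ∀ {s t h d'} → d ≡ suc d' → nbr s h ≡ t → (∀ i → ∃[ x ] (x ≢ t × EdgeIn (T i) s x)) → r ≤ d'
    avoiding-bound {s} {t} {h} refl st≡ ends = Finₚ.injective⇒≤ {f = λ i → punchOut (h≢ i)}
      λ eq → position-injective (Finₚ.punchOut-injective (h≢ _) (h≢ _) eq)
      where
      first : ∀ i → ∃[ x ] EdgeIn (T i) s x
      first i = let x , _ , e = ends i in x , e
      open Ends F first
      h≢ : ∀ i → h ≢ proj₁ (position i)
      h≢ i eq = proj₁ (proj₂ (ends i)) (trans (proj₂ (position i)) (trans (cong (nbr s) (sym eq)) st≡))

    -- If every tree has an edge at u other than uv, count those edges; otherwise the tree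
    -- lacking one uses the edge uv, so every tree has an edge at v other than uv.
    adjacent-bound : ∀ {d'} → d ≡ suc d' → r ≤ d'
    adjacent-bound d≡ = [ avoiding-bound d≡ uv , fromV ]′ choose
      where
      ends : ∀ i → _
      ends i = exit {T = T i} u≢w v≢w (S-walk (st i) u∈ w∈)
      split : ∀ {m} {A B : Fin m → Set} → (∀ i → A i ⊎ B i) → (∀ i → A i) ⊎ ∃ B
      split {zero}  f = inj₁ λ ()
      split {suc m} f with f zero | split (f ∘ suc)
      ... | inj₂ b | _            = inj₂ (zero , b)
      ... | inj₁ _ | inj₂ (i , b) = inj₂ (suc i , b)
      ... | inj₁ a | inj₁ as      = inj₁ λ { zero → a ; (suc i) → as i }
      choose = split ends
      module _ (E : ∃[ i ] ((∃[ x ] (x ≢ u × EdgeIn (T i) v x)) × EdgeIn (T i) u v)) where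
        i = proj₁ E
        ends' : ∀ j → ∃[ x ] (x ≢ u × EdgeIn (T j) v x)
        ends' j with i Finₚ.≟ j
        ... | yes refl = proj₁ (proj₂ E)
        ... | no i≢j with exit {T = T j} v≢w u≢w (S-walk (st j) v∈ w∈)
        ...   | inj₁ f       = f
        ...   | inj₂ (_ , f) = ⊥-elim (proj₂ (disj i j i≢j) u v (proj₂ (proj₂ E)) (edge-sym {T = T j} f))
      fromV : _ → _
      fromV E = avoiding-bound d≡ vu (ends' E)

-- Signed words and prefix reversals

negate-involutive : ∀ {n} (a : SElt n) → negate (negate a) ≡ a
negate-involutive (a , b) = cong (a ,_) (Boolₚ.not-involutive b)

negate-≢ : ∀ {n} (a : SElt n) → negate a ≢ a
negate-≢ (a , true)  ()
negate-≢ (a , false) ()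

same-abs : ∀ {n} (a b : SElt n) → proj₁ a ≡ proj₁ b → a ≡ b ⊎ a ≡ negate b
same-abs (a , true)  (_ , true)  refl = inj₁ refl
same-abs (a , true)  (_ , false) refl = inj₂ refl
same-abs (a , false) (_ , true)  refl = inj₂ refl
same-abs (a , false) (_ , false) refl = inj₁ refl

_≟ₑ_ : ∀ {n} → DecidableEquality (SElt n)
_≟ₑ_ = ≡-dec Finₚ._≟_ Boolₚ._≟_

_≟ʷ_ : ∀ {n} → DecidableEquality (SWord n)
_≟ʷ_ = Listₚ.≡-dec _≟ₑ_

rev : ∀ {n} → SWord n → SWord n
rev x = map negate (reverse x)

rev-++ : ∀ {n} (x y : SWord n) → rev (x ++ y) ≡ rev y ++ rev x
rev-++ x y = trans (cong (map negate) (Listₚ.reverse-++ x y)) (Listₚ.map-++ negate (reverse y) (reverse x))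

rev-∷ : ∀ {n} (a : SElt n) x → rev (a ∷ x) ≡ rev x ++ [ negate a ]
rev-∷ a x = rev-++ [ a ] x

rev-∷ʳ : ∀ {n} (x : SWord n) a → rev (x ++ [ a ]) ≡ negate a ∷ rev x
rev-∷ʳ x a = rev-++ x [ a ]

rev-involutive : ∀ {n} (x : SWord n) → rev (rev x) ≡ x
rev-involutive []      = refl
rev-involutive (a ∷ x) = begin
  rev (rev (a ∷ x))                 ≡⟨ cong rev (rev-∷ a x) ⟩
  rev (rev x ++ [ negate a ])       ≡⟨ rev-∷ʳ (rev x) (negate a) ⟩
  negate (negate a) ∷ rev (rev x)   ≡⟨ cong₂ _∷_ (negate-involutive a) (rev-involutive x) ⟩
  a ∷ x                             ∎
  where open ≡-Reasoning

rev-length : ∀ {n} (x : SWord n) → length (rev x) ≡ length x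
rev-length x = trans (Listₚ.length-map negate (reverse x)) (Listₚ.length-reverse x)

rev-abs : ∀ {n} (x : SWord n) → map proj₁ (rev x) ↭ map proj₁ x
rev-abs x = subst (_↭ map proj₁ x) (Listₚ.map-∘ (reverse x)) (↭ₚ.map⁺ proj₁ (↭ₚ.↭-reverse x))

take-length-++ : ∀ {A : Set} (x y : List A) → take (length x) (x ++ y) ≡ x
take-length-++ []      y = refl
take-length-++ (a ∷ x) y = cong (a ∷_) (take-length-++ x y)

drop-length-++ : ∀ {A : Set} (x y : List A) → drop (length x) (x ++ y) ≡ y
drop-length-++ []      y = refl
drop-length-++ (a ∷ x) y = drop-length-++ x y

prefixRev-++ : ∀ {n} (x y : SWord n) → prefixRev (x ++ y) (length x) ≡ rev x ++ y
prefixRev-++ x y = cong₂ (λ p q → rev p ++ q) (take-length-++ x y) (drop-length-++ x y)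

split-at : ∀ {A : Set} (x : List A) i → i < length x → ∃[ u ] ∃[ a ] ∃[ z ] (x ≡ u ++ a ∷ z × length u ≡ i)
split-at (a ∷ x) zero    _        = [] , a , x , refl , refl
split-at (a ∷ x) (suc i) (s≤s lt) = let u , b , z , eq , l = split-at x i lt in
  a ∷ u , b , z , cong (a ∷_) eq , cong suc l

-- The result of reversing the prefix `u ++ [ a ]` of `u ++ a ∷ z`. Splitting at `a` shows the
-- symbol brought to the front, so the neighbours of a word are indexed by symbols rather than by
-- lengths.
turn : ∀ {n} → SWord n → SElt n → SWord n → SWord n
turn u a z = negate a ∷ (rev u ++ z)

turn-block : ∀ {n} (u : SWord n) a z → rev (u ++ [ a ]) ++ z ≡ turn u a z
turn-block u a z = cong (_++ z) (rev-∷ʳ u a)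

length-∷ʳ : ∀ {A : Set} (u : List A) a → length (u ++ [ a ]) ≡ suc (length u)
length-∷ʳ u a = trans (Listₚ.length-++ u) (ℕₚ.+-comm (length u) 1)

module _ {A B : Set} (f : A → B) where

  ∈-map-≡ : ∀ {a b xs} → f a ≡ f b → b ∈ xs → f a ∈ map f xs
  ∈-map-≡ {xs = xs} eq b∈ = subst (λ c → c ∈ map f xs) (sym eq) (∈ₚ.∈-map⁺ f b∈)

  unique-position : ∀ {u a z u' a' z'} → Unique (map f (u ++ a ∷ z)) → u ++ a ∷ z ≡ u' ++ a' ∷ z' → f a ≡ f a' →
                    u ≡ u' × a ≡ a' × z ≡ z'
  unique-position {[]}    {u' = []}     _ refl _ = refl , refl , refl
  unique-position {[]}    {u' = b ∷ u'} (a∉ ∷ _) refl fa≡ =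
    ⊥-elim (Allₚ.All¬⇒¬Any a∉ (∈-map-≡ fa≡ (∈ₚ.∈-++⁺ʳ u' (here refl))))
  unique-position {b ∷ u} {u' = []}     (a∉ ∷ _) refl fa≡ =
    ⊥-elim (Allₚ.All¬⇒¬Any a∉ (∈-map-≡ (sym fa≡) (∈ₚ.∈-++⁺ʳ u (here refl))))
  unique-position {b ∷ u} {u' = c ∷ u'} (_ ∷ U) eq fa≡ with Listₚ.∷-injective eq
  ... | refl , eq' with unique-position U eq' fa≡
  ... | refl , refl , refl = refl , refl , refl

  unique-∈ : ∀ {x a b} → Unique (map f x) → a ∈ x → b ∈ x → f a ≡ f b → a ≡ b
  unique-∈ (_ ∷ _) (here refl) (here refl) _ = refl
  unique-∈ (a∉ ∷ _) (here refl) (there b∈) eq = ⊥-elim (Allₚ.All¬⇒¬Any a∉ (∈-map-≡ eq b∈))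
  unique-∈ (b∉ ∷ _) (there a∈) (here refl) eq = ⊥-elim (Allₚ.All¬⇒¬Any b∉ (∈-map-≡ (sym eq) a∈))
  unique-∈ (_ ∷ U) (there a∈) (there b∈) eq = unique-∈ U a∈ b∈ eq

unique-↭ : ∀ {A : Set} {xs ys : List A} → xs ↭ ys → Unique xs → Unique ys
unique-↭ p = ↭ₛₚ.Unique-resp-↭ (setoid _) (↭⇒↭ₛ p)

-- The burnt pancake graph and its clusters

module Pancake (m : ℕ) where

  n : ℕ
  n = suc (suc m)

  V : Set
  V = SWord n

  abs : SElt n → Fin n
  abs = proj₁

  Perm : V → Set
  Perm = IsSignedPerm n

  _~_ : V → V → Set
  _~_ = Adj (BP n)

  perm-↭ : ∀ {x y} → map proj₁ x ↭ map proj₁ y → Perm x → Perm y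
  perm-↭ {x} {y} p (l , u) =
    trans (sym (Listₚ.length-map proj₁ y)) (trans (sym (↭ₚ.↭-length p)) (trans (Listₚ.length-map proj₁ x) l)) ,
    unique-↭ p u

  block-↭ : ∀ (v z : V) → map proj₁ (v ++ z) ↭ map proj₁ (rev v ++ z)
  block-↭ v z = subst₂ _↭_ (sym (Listₚ.map-++ proj₁ v z)) (sym (Listₚ.map-++ proj₁ (rev v) z))
    (↭ₚ.++⁺ʳ (map proj₁ z) (↭-sym (rev-abs v)))

  block-perm : ∀ v z → Perm (v ++ z) → Perm (rev v ++ z)
  block-perm v z = perm-↭ (block-↭ v z)

  block-adj : ∀ v z → 1 ≤ length v → Perm (v ++ z) → (v ++ z) ~ (rev v ++ z)
  block-adj v z 1≤ (l , _) = length v , 1≤ ,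
    ℕₚ.≤-trans (ℕₚ.m≤m+n _ (length z)) (ℕₚ.≤-reflexive (trans (sym (Listₚ.length-++ v)) l)) ,
    sym (prefixRev-++ v z)

  turn-perm : ∀ u a z → Perm (u ++ a ∷ z) → Perm (turn u a z)
  turn-perm u a z p = subst Perm (turn-block u a z)
    (block-perm (u ++ [ a ]) z (subst Perm (sym (Listₚ.++-assoc u [ a ] z)) p))

  turn-adj : ∀ u a z → Perm (u ++ a ∷ z) → (u ++ a ∷ z) ~ turn u a z
  turn-adj u a z p = subst₂ _~_ (Listₚ.++-assoc u [ a ] z) (turn-block u a z)
    (block-adj (u ++ [ a ]) z (subst (1 ≤_) (sym (length-∷ʳ u a)) (s≤s z≤n))
      (subst Perm (sym (Listₚ.++-assoc u [ a ] z)) p))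

  adj⇒turn : ∀ {x y} → Perm x → x ~ y → ∃[ u ] ∃[ a ] ∃[ z ] (x ≡ u ++ a ∷ z × y ≡ turn u a z)
  adj⇒turn {x} (l , _) (suc i , _ , i≤n , refl) with split-at x i (subst (suc i ≤_) (sym l) i≤n)
  ... | u , a , z , refl , refl = u , a , z , refl , (begin
    prefixRev (u ++ a ∷ z) (suc (length u))                  ≡⟨ cong₂ prefixRev (sym (Listₚ.++-assoc u [ a ] z)) (sym (length-∷ʳ u a)) ⟩
    prefixRev ((u ++ [ a ]) ++ z) (length (u ++ [ a ]))      ≡⟨ prefixRev-++ (u ++ [ a ]) z ⟩
    rev (u ++ [ a ]) ++ z                                    ≡⟨ turn-block u a z ⟩
    turn u a z                                               ∎)
    where open ≡-Reasoning

  adj-perm : ∀ {x y} → Perm x → x ~ y → Perm y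
  adj-perm p a with adj⇒turn p a
  ... | u , b , z , refl , refl = turn-perm u b z p

  adj-sym : ∀ {x y} → Perm x → x ~ y → y ~ x
  adj-sym p a with adj⇒turn p a
  ... | u , b , z , refl , refl = subst₂ _~_ (turn-block u b z)
    (trans (cong (_++ z) (rev-involutive (u ++ [ b ]))) (Listₚ.++-assoc u [ b ] z))
    (block-adj (rev (u ++ [ b ])) z
       (subst (1 ≤_) (sym (trans (rev-length (u ++ [ b ])) (length-∷ʳ u b))) (s≤s z≤n))
       (subst Perm (sym (turn-block u b z)) (turn-perm u b z p)))

  -- A missing symbol would extend the word to n + 1 distinct elements of `Fin n`.
  symbol∈ : ∀ {x} → Perm x → ∀ j → j ∈ map proj₁ x
  symbol∈ {x} (l , u) j with j ∈? map proj₁ x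
    where open Dec∈ Finₚ._≟_ using (_∈?_)
  ... | yes j∈ = j∈
  ... | no j∉  = ⊥-elim (ℕₚ.1+n≰n (subst₂ _≤_ (cong suc (trans (Listₚ.length-map proj₁ x) l)) (Listₚ.length-tabulate id)
                   (unique-⊆-length {xs = j ∷ map proj₁ x} {ys = allFin n} (Allₚ.¬Any⇒All¬ _ j∉ ∷ u) (λ _ → ∈ₚ.∈-allFin _))))

  symbol-split : ∀ {x} → Perm x → ∀ j → ∃[ u ] ∃[ a ] ∃[ z ] (x ≡ u ++ a ∷ z × abs a ≡ j)
  symbol-split p j with ∈ₚ.∈-map⁻ proj₁ (symbol∈ p j)
  ... | a , a∈ , refl with ∈ₚ.∈-∃++ a∈
  ... | u , z , eq = u , a , z , eq , refl

  -- The values on the empty word are junk: a vertex of BP n is never empty.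
  hd lst : V → SElt n
  hd []      = zero , false
  hd (a ∷ _) = a
  lst []          = zero , false
  lst (a ∷ [])    = a
  lst (_ ∷ b ∷ x) = lst (b ∷ x)

  lst-++ : ∀ u a z → lst (u ++ a ∷ z) ≡ lst (a ∷ z)
  lst-++ []          a z = refl
  lst-++ (_ ∷ [])    a z = refl
  lst-++ (_ ∷ b ∷ u) a z = lst-++ (b ∷ u) a z

  lst-snoc : ∀ {x} → Perm x → ∃[ u ] x ≡ u ++ [ lst x ]
  lst-snoc {a ∷ x} _ = go a x
    where
    go : ∀ a x → ∃[ u ] a ∷ x ≡ u ++ [ lst (a ∷ x) ]
    go a []      = [] , refl
    go a (b ∷ x) = let u , eq = go b x in a ∷ u , cong (a ∷_) eq

  turn-lst : ∀ u a b z → lst (turn u a (b ∷ z)) ≡ lst (u ++ a ∷ b ∷ z)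
  turn-lst u a b z = trans (lst-++ (negate a ∷ rev u) b z) (sym (lst-++ u a (b ∷ z)))

  abs-unique : ∀ {x} → Perm x → ∀ {a b} → a ∈ x → b ∈ x → abs a ≡ abs b → a ≡ b
  abs-unique {x} (_ , u) = unique-∈ proj₁ {x = x} u

  hd≢lst : ∀ {x} → Perm x → abs (hd x) ≢ abs (lst x)
  hd≢lst {a ∷ b ∷ x} (_ , a∉ ∷ _) eq with lst-snoc' b x
    where
    lst-snoc' : ∀ b x → lst (b ∷ x) ∈ b ∷ x
    lst-snoc' b []      = here refl
    lst-snoc' b (c ∷ x) = there (lst-snoc' c x)
  ... | l∈ = Allₚ.All¬⇒¬Any a∉ (∈-map-≡ proj₁ {a} eq l∈)

  flip : V → V
  flip x = rev x

  flip-perm : ∀ {x} → Perm x → Perm (flip x)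
  flip-perm {x} p = subst Perm (Listₚ.++-identityʳ (rev x)) (block-perm x [] (subst Perm (sym (Listₚ.++-identityʳ x)) p))

  flip-adj : ∀ {x} → Perm x → x ~ flip x
  flip-adj {x} p@(l , _) = subst₂ _~_ (Listₚ.++-identityʳ x) (Listₚ.++-identityʳ (rev x))
    (block-adj x [] (subst (1 ≤_) (sym l) (s≤s z≤n)) (subst Perm (sym (Listₚ.++-identityʳ x)) p))

  flip-lst : ∀ {x} → Perm x → lst (flip x) ≡ negate (hd x)
  flip-lst {a ∷ x} _ = trans (cong lst (rev-∷ a x)) (lst-++ (rev x) (negate a) [])

  flip-hd : ∀ {x} → Perm x → hd (flip x) ≡ negate (lst x)
  flip-hd {x} p = let u , eq = lst-snoc p in cong hd (trans (cong rev eq) (rev-∷ʳ u (lst x)))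

  -- The words with a given last symbol form a cluster, a copy of BP (n - 1).
  _≈_ : V → V → Set
  x ≈ y = Perm x × Perm y × x ~ y × lst x ≡ lst y

  turn-≈ : ∀ u a b z → Perm (u ++ a ∷ b ∷ z) → (u ++ a ∷ b ∷ z) ≈ turn u a (b ∷ z)
  turn-≈ u a b z p = p , turn-perm u a (b ∷ z) p , turn-adj u a (b ∷ z) p , sym (turn-lst u a b z)

  -- The letter `b` behind `a` witnesses that the reversal ending at `a` is shorter than the word
  -- and so stays in the cluster.
  bring : ∀ {x j} → Perm x → j ≢ abs (lst x) →
          ∃[ u ] ∃[ a ] ∃[ b ] ∃[ z ] (x ≡ u ++ a ∷ b ∷ z × abs a ≡ j)
  bring {j = j} p j≢ with symbol-split p j
  ... | u , a , [] , refl , refl    = ⊥-elim (j≢ (cong abs (sym (lst-++ u a []))))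
  ... | u , a , b ∷ z , eq , abs-a = u , a , b , z , eq , abs-a

  bring-hd : ∀ {x j} → Perm x → j ≢ abs (lst x) → ∃[ y ] (x ≈ y × abs (hd y) ≡ j)
  bring-hd p j≢ with bring p j≢
  ... | u , a , b , z , refl , refl = turn u a (b ∷ z) , turn-≈ u a b z p , refl

  head-turn : ∀ {x} → Perm x → ∃[ y ] (x ≈ y × hd y ≡ negate (hd x) × drop 1 y ≡ drop 1 x)
  head-turn {a ∷ b ∷ x} p = turn [] a (b ∷ x) , turn-≈ [] a b x p , refl , refl
  head-turn {_ ∷ []} (() , _)

  set-sign : ∀ {x} b → Perm x → abs b ≡ abs (hd x) → hd x ≡ b ⊎ ∃[ y ] (x ≈ y × hd y ≡ b × drop 1 y ≡ drop 1 x)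
  set-sign {x} b p eq with same-abs b (hd x) eq
  ... | inj₁ refl = inj₁ refl
  ... | inj₂ refl = inj₂ (head-turn p)

  steer : ∀ {x} b → Perm x → abs b ≢ abs (lst x) → ∃[ y ] (Star _≈_ x y × Perm y × hd y ≡ b × lst y ≡ lst x)
  steer b p b≢ with bring-hd p b≢
  ... | y , xy@(_ , q , _ , l) , eq with set-sign b q (sym eq)
  ... | inj₁ h = y , xy ◅ ε , q , h , sym l
  ... | inj₂ (w , yw@(_ , r , _ , l') , h , _) = w , xy ◅ yw ◅ ε , r , h , sym (trans l l')

  -- Adjacency that respects a suffix of any length; the induction for connectedness fixes one more
  -- symbol at each stage.
  _≈[_]_ : V → V → V → Set
  x ≈[ z ] y = Perm x × Perm y × x ~ y × (∃[ u ] x ≡ u ++ z) × (∃[ u ] y ≡ u ++ z)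

  block-≈ : ∀ v z → 1 ≤ length v → Perm (v ++ z) → (v ++ z) ≈[ z ] (rev v ++ z)
  block-≈ v z 1≤ p = p , block-perm v z p , block-adj v z 1≤ p , (v , refl) , (rev v , refl)

  ≈-weaken : ∀ {x y} q z → x ≈[ q ++ z ] y → x ≈[ z ] y
  ≈-weaken q z (p , p' , e , (u , refl) , (v , refl)) =
    p , p' , e , (u ++ q , sym (Listₚ.++-assoc u q z)) , (v ++ q , sym (Listₚ.++-assoc v q z))

  star-perm : ∀ {z x y} → Perm x → Star _≈[ z ]_ x y → Perm y
  star-perm p ε                  = p
  star-perm p ((_ , q , _) ◅ st) = star-perm q st

  -- The sign wanted in front is that of `negate a`, because the next reversal of the whole block
  -- puts `a` itself at the end of the block.
  to-front : ∀ u z a → Perm (u ++ z) → abs a ∈ map proj₁ u →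
             ∃[ r ] (length u ≡ suc (length r) × Star _≈[ z ]_ (u ++ z) (negate a ∷ (r ++ z)))
  to-front u z a p a∈ with ∈ₚ.∈-map⁻ proj₁ a∈
  ... | c , c∈ , abs-eq with ∈ₚ.∈-∃++ c∈
  ... | v , q , refl = rev v ++ q , len , st
    where
    len : length (v ++ c ∷ q) ≡ suc (length (rev v ++ q))
    len = begin
      length (v ++ c ∷ q)             ≡⟨ Listₚ.length-++ v ⟩
      length v + suc (length q)       ≡⟨ ℕₚ.+-suc (length v) (length q) ⟩
      suc (length v + length q)       ≡⟨ cong (λ k → suc (k + length q)) (sym (rev-length v)) ⟩
      suc (length (rev v) + length q) ≡⟨ cong suc (sym (Listₚ.length-++ (rev v))) ⟩
      suc (length (rev v ++ q))       ∎
      where open ≡-Reasoning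
    eq₁ : (v ++ c ∷ q) ++ z ≡ (v ++ [ c ]) ++ (q ++ z)
    eq₁ = trans (Listₚ.++-assoc v (c ∷ q) z) (sym (Listₚ.++-assoc v [ c ] (q ++ z)))
    eq₂ : rev (v ++ [ c ]) ++ (q ++ z) ≡ negate c ∷ ((rev v ++ q) ++ z)
    eq₂ = trans (turn-block v c (q ++ z)) (cong (negate c ∷_) (sym (Listₚ.++-assoc (rev v) q z)))
    st₁ : ((v ++ c ∷ q) ++ z) ≈[ z ] (negate c ∷ ((rev v ++ q) ++ z))
    st₁ = subst₂ _≈[ z ]_ (sym eq₁) eq₂ (≈-weaken q z
      (block-≈ (v ++ [ c ]) (q ++ z) (subst (1 ≤_) (sym (length-∷ʳ v c)) (s≤s z≤n)) (subst Perm eq₁ p)))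
    st : Star _≈[ z ]_ ((v ++ c ∷ q) ++ z) (negate a ∷ ((rev v ++ q) ++ z))
    st with same-abs c a (sym abs-eq)
    ... | inj₁ refl = st₁ ◅ ε
    ... | inj₂ refl = st₁ ◅ ≈-weaken (rev v ++ q) z second ◅ ε
      where
      second : (negate (negate a) ∷ ((rev v ++ q) ++ z)) ≈[ (rev v ++ q) ++ z ] (negate a ∷ ((rev v ++ q) ++ z))
      second = subst (λ b → (negate (negate a) ∷ ((rev v ++ q) ++ z)) ≈[ (rev v ++ q) ++ z ] (b ∷ ((rev v ++ q) ++ z)))
        (negate-involutive (negate a))
        (block-≈ [ negate (negate a) ] ((rev v ++ q) ++ z) (s≤s z≤n) (proj₁ (proj₂ st₁)))

  -- Pancake sorting: the last symbol of the target block is brought to the front, reversing the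
  -- block moves it into place, and it joins the fixed suffix.
  suffix-connected : ∀ k u u' z → length u ≡ k → length u' ≡ k → Perm (u ++ z) → Perm (u' ++ z) →
                     Star _≈[ z ]_ (u ++ z) (u' ++ z)
  suffix-connected zero [] [] z _ _ _ _ = ε
  suffix-connected (suc k) u u' z lu lu' p p' with initLast u'
  ... | u″ ∷ʳ′ a = result
    where
    eq' : (u″ ++ [ a ]) ++ z ≡ u″ ++ a ∷ z
    eq' = Listₚ.++-assoc u″ [ a ] z
    a∉z : abs a ∉ map proj₁ z
    a∉z a∈ with ∈ₚ.∈-map⁻ proj₁ a∈
    ... | b , b∈ , abs-eq with ∈ₚ.∈-∃++ b∈
    ... | v , q , refl with unique-position proj₁ {u = u″} {u' = (u″ ++ a ∷ v)} (subst (λ x → Unique (map proj₁ x)) eq' (proj₂ p'))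
                              (sym (Listₚ.++-assoc u″ (a ∷ v) (b ∷ q))) abs-eq
    ... | u≡ , _ = case trans (cong length u≡) (trans (Listₚ.length-++ u″) (ℕₚ.+-suc (length u″) _)) of
                     λ eq → ℕₚ.m≢1+m+n (length u″) eq
    a∈u : abs a ∈ map proj₁ u
    a∈u with ∈ₚ.∈-++⁻ (map proj₁ u) (subst (λ l → abs a ∈ l) (Listₚ.map-++ proj₁ u z) (symbol∈ p (abs a)))
    ... | inj₁ a∈ = a∈
    ... | inj₂ a∈ = ⊥-elim (a∉z a∈)
    result : Star _≈[ z ]_ (u ++ z) ((u″ ++ [ a ]) ++ z)
    result with to-front u z a p a∈u
    ... | r , lr , st = st ◅◅ block-≈ (negate a ∷ r) z (s≤s z≤n) (star-perm p st) ◅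
          subst₂ (Star _≈[ z ]_) (sym eq″) (sym eq')
            (gmap id (≈-weaken [ a ] z) (suffix-connected k (rev r) u″ (a ∷ z)
              (trans (rev-length r) (ℕₚ.suc-injective (trans (sym lr) lu)))
              (ℕₚ.suc-injective (trans (sym (length-∷ʳ u″ a)) lu'))
              (subst Perm eq″ (block-perm (negate a ∷ r) z (star-perm p st))) (subst Perm eq' p')))
      where
      eq″ : rev (negate a ∷ r) ++ z ≡ rev r ++ a ∷ z
      eq″ = trans (cong (_++ z) (trans (rev-∷ (negate a) r) (cong (λ b → rev r ++ [ b ]) (negate-involutive a))))
                  (Listₚ.++-assoc (rev r) [ a ] z)

  connected : ∀ {x y} → Perm x → Perm y → Star (λ v w → Perm v × Perm w × v ~ w) x y
  connected {x} {y} p q = subst₂ (Star _) (Listₚ.++-identityʳ x) (Listₚ.++-identityʳ y)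
    (gmap id (λ { (p , q , e , _) → p , q , e })
      (suffix-connected n x y [] (proj₁ p) (proj₁ q) (subst Perm (sym (Listₚ.++-identityʳ x)) p)
                        (subst Perm (sym (Listₚ.++-identityʳ y)) q)))

  cluster-connected : ∀ {x y} → Perm x → Perm y → lst x ≡ lst y → Star _≈_ x y
  cluster-connected {x} {y} p q l = go (lst-snoc p) (lst-snoc q)
    where
    lst-suffix : ∀ {x} a → (∃[ u ] x ≡ u ++ [ a ]) → lst x ≡ a
    lst-suffix a (u , refl) = lst-++ u a []
    go : (∃[ u ] x ≡ u ++ [ lst x ]) → (∃[ u ] y ≡ u ++ [ lst y ]) → Star _≈_ x y
    go (u , x≡) (u' , y≡) = subst₂ (Star _≈_) (sym x≡) (sym y≡')
      (gmap id (λ { (p , q , e , su , sv) → p , q , e , trans (lst-suffix (lst x) su) (sym (lst-suffix (lst x) sv)) })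
        (suffix-connected (suc m) u u' [ lst x ] (len u (trans (sym (cong length x≡)) (proj₁ p)))
          (len u' (trans (sym (cong length y≡')) (proj₁ q))) (subst Perm x≡ p) (subst Perm y≡' q)))
      where
      y≡' : y ≡ u' ++ [ lst x ]
      y≡' = trans y≡ (cong (λ a → u' ++ [ a ]) (sym l))
      len : ∀ v {a} → length (v ++ [ a ]) ≡ n → length v ≡ suc m
      len v {a} eq = ℕₚ.suc-injective (trans (sym (length-∷ʳ v a)) eq)

  -- The symbol brought to the front occurs once in `x` and thus fixes the length of the reversal.
  neighbours-hd : ∀ {x y z} → Perm x → x ~ y → x ~ z → abs (hd y) ≡ abs (hd z) → y ≡ z
  neighbours-hd p e f eq with adj⇒turn p e | adj⇒turn p f
  ... | u , a , w , refl , refl | u' , a' , w' , x≡ , refl with unique-position proj₁ (proj₂ p) x≡ eq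
  ... | refl , refl , refl = refl

  -- Everything in the reversed block changes sign, so only the untouched suffix can keep a signed
  -- symbol.
  ∈-turn : ∀ {u a w c} → Perm (u ++ a ∷ w) → c ∈ u ++ a ∷ w → c ∈ turn u a w → c ∈ w
  ∈-turn {u} {a} p c∈ (here refl) = ⊥-elim (negate-≢ a (abs-unique p c∈ (∈ₚ.∈-++⁺ʳ u (here refl)) refl))
  ∈-turn {u} {a} p c∈ (there c∈') with ∈ₚ.∈-++⁻ (rev u) c∈'
  ... | inj₂ c∈w = c∈w
  ... | inj₁ c∈r with ∈ₚ.∈-map⁻ negate c∈r
  ...   | b , b∈ , refl = ⊥-elim (negate-≢ b (abs-unique p c∈ (∈ₚ.∈-++⁺ˡ {xs = u} (Anyₚ.reverse⁻ b∈)) refl))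

  -- The head of `z` shows that the same signed symbol comes to the front from `x` and from `y`. It
  -- has one sign in both, so it lies in the suffix untouched between `x` and `y`. Both reversals
  -- leading to `z` then cover all the places where `x` and `y` differ, and undoing them gives
  -- `x ≡ y`.
  no-triangle : ∀ {x y z} → Perm x → x ~ y → x ~ z → y ~ z → x ≢ y → ⊥
  no-triangle p e f g x≢y with adj⇒turn p e | adj⇒turn p f | adj⇒turn (adj-perm p e) g
  ... | u , a , w , refl , refl | u' , a' , w' , x≡ , refl | u″ , a″ , w″ , y≡ , z≡
    with negate-injective a' a″ (cong hd z≡)
    where
    negate-injective : ∀ (a b : SElt n) → negate a ≡ negate b → a ≡ b
    negate-injective a b eq = trans (sym (negate-involutive a)) (trans (cong negate eq) (negate-involutive b))
  ... | refl with ∈ₚ.∈-∃++ (∈-turn {u} {a} {w} p (subst (λ v → a' ∈ v) (sym x≡) (∈ₚ.∈-++⁺ʳ u' (here refl)))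
                                 (subst (λ v → a' ∈ v) (sym y≡) (∈ₚ.∈-++⁺ʳ u″ (here refl))))
  ... | w₁ , w₂ , refl
    with unique-position proj₁ {u = u ++ a ∷ w₁} (subst (λ v → Unique (map proj₁ v)) x-eq (proj₂ p)) (trans (sym x-eq) x≡) refl
       | unique-position proj₁ {u = negate a ∷ (rev u ++ w₁)} (subst (λ v → Unique (map proj₁ v)) y-eq (proj₂ (turn-perm u a _ p)))
                         (trans (sym y-eq) y≡) refl
    where
    x-eq : u ++ a ∷ w₁ ++ a' ∷ w₂ ≡ (u ++ a ∷ w₁) ++ a' ∷ w₂
    x-eq = sym (Listₚ.++-assoc u (a ∷ w₁) (a' ∷ w₂))
    y-eq : turn u a (w₁ ++ a' ∷ w₂) ≡ (negate a ∷ (rev u ++ w₁)) ++ a' ∷ w₂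
    y-eq = cong (negate a ∷_) (sym (Listₚ.++-assoc (rev u) w₁ (a' ∷ w₂)))
  ... | refl , _ , refl | refl , _ , refl = x≢y (trans x≡ (trans (cong (_++ a' ∷ w₂) u'≡u″) (sym y≡)))
    where
    u'≡u″ : u' ≡ u″
    u'≡u″ = trans (sym (rev-involutive u')) (trans (cong rev (Listₚ.++-cancelʳ w₂ (rev u') (rev u″) (cong (drop 1) z≡)))
              (rev-involutive u″))

-- Disjoint trees from a labelling of the words

module Assembly (m : ℕ) where
  open Pancake m
  open Families (BP n) _≟ʷ_ adj-sym

  module Link (S : List V) (ℓ : V → Fin n) (Arc : V → V → Set) where

    -- The edges available to the tree of label j. A vertex of S may be entered or left along
    -- arcs, whatever its own label; the vertices of S with label j also serve as ordinary
    -- vertices of the tree.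
    Link : Fin n → V → V → Set
    Link j x y = Perm x × Perm y × x ~ y × ℓ y ≡ j × (ℓ x ≡ j ⊎ (x ∈ S × Arc x y))

    module _ (one-way : ∀ {s t} → s ∈ S → t ∈ S → s ~ t → Arc s t → Arc t s → ℓ s ≡ ℓ t)
             {p : Fin n} (root : Fin n → V) (root-perm : ∀ j → Perm (root j))
             (root-label : ∀ j → j ≢ p → ℓ (root j) ≡ j)
             (paths : ∀ {s} j → j ≢ p → s ∈ S → Star (Link j) s (root j)) where

      private
        tag : Fin (suc m) → Fin n
        tag = punchIn p

        module GL i = Growth _≟ʷ_ (Link (tag i))

        link⇒step : ∀ {j x y} → Link j x y → Step x y
        link⇒step (px , _ , a , _) = px , a

        tree : ∀ i → ∃[ vs ] ∃[ es ] (GL.Grown i (root (tag i)) vs es × S ⊆ vs)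
        tree i = GL.attachAll i S (λ s → paths (tag i) (Finₚ.punchInᵢ≢i p i))

        subgraph : Fin (suc m) → Sub V
        subgraph i = let vs , es , _ = tree i in sub vs es

        vertex-label : ∀ i {v} → v ∈ verts (subgraph i) → ℓ v ≡ tag i ⊎ v ∈ S
        vertex-label i v∈ with GL.vertex⇒ i (proj₁ (proj₂ (proj₂ (tree i)))) v∈
        ... | inj₁ refl = inj₁ (root-label (tag i) (Finₚ.punchInᵢ≢i p i))
        ... | inj₂ (_ , _ , _ , _ , _ , inj₁ eq) = inj₁ eq
        ... | inj₂ (_ , _ , _ , _ , _ , inj₂ (v∈S , _)) = inj₂ v∈S

        edge-link : ∀ i {u v} → EdgeIn (subgraph i) u v → Link (tag i) u v ⊎ Link (tag i) v u
        edge-link i (inj₁ e) = inj₁ (proj₂ (proj₂ (GL.edge⇒R i (proj₁ (proj₂ (proj₂ (tree i)))) e)))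
        edge-link i (inj₂ e) = inj₂ (proj₂ (proj₂ (GL.edge⇒R i (proj₁ (proj₂ (proj₂ (tree i)))) e)))

        -- If either tail has the label of its own tree, that label is also the label of the other
        -- tree. What remains is an edge between two vertices of `S` taken both ways, and this is
        -- the business of `one-way`.
        opposite : ∀ {i j x y} → Link i x y → Link j y x → i ≡ j
        opposite (_ , _ , _ , ℓy , inj₁ ℓx) (_ , _ , _ , ℓx' , _) = trans (sym ℓx) ℓx'
        opposite (_ , _ , _ , ℓy , inj₂ _) (_ , _ , _ , _ , inj₁ ℓy') = trans (sym ℓy) ℓy'
        opposite (_ , _ , a , ℓy , inj₂ (x∈ , xy)) (_ , _ , _ , ℓx , inj₂ (y∈ , yx)) =
          trans (sym ℓy) (trans (sym (one-way x∈ y∈ a xy yx)) ℓx)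

        same-tag : ∀ {i j x y} → Link i x y ⊎ Link i y x → Link j x y ⊎ Link j y x → i ≡ j
        same-tag (inj₁ (_ , _ , _ , l , _)) (inj₁ (_ , _ , _ , l' , _)) = trans (sym l) l'
        same-tag (inj₂ (_ , _ , _ , l , _)) (inj₂ (_ , _ , _ , l' , _)) = trans (sym l) l'
        same-tag (inj₁ k) (inj₂ k') = opposite k k'
        same-tag (inj₂ k) (inj₁ k') = opposite k k'

        disjoint : ∀ i j → i ≢ j → IntEdgeDisjoint S (subgraph i) (subgraph j)
        disjoint i j i≢j = vertices , λ u v e f → i≢j (Finₚ.punchIn-injective p i j (same-tag (edge-link i e) (edge-link j f)))
          where
          vertices : ∀ v → v ∈ verts (subgraph i) → v ∈ verts (subgraph j) → v ∈ S
          vertices v v∈ v∈' with vertex-label i v∈ | vertex-label j v∈'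
          ... | inj₂ v∈S | _ = v∈S
          ... | inj₁ _ | inj₂ v∈S = v∈S
          ... | inj₁ l | inj₁ l' = ⊥-elim (i≢j (Finₚ.punchIn-injective p i j (trans (sym l) l')))

      assemble : Family (BP n) S (suc m)
      assemble = subgraph ,
        (λ i → let _ , _ , g , S⊆ = tree i in grown-STree (root-perm (tag i)) (grown-map link⇒step g) S⊆) ,
        disjoint

  unbarred : Fin n → SElt n
  unbarred i = i , false

  some-perm : Perm (tabulate unbarred)
  some-perm = Listₚ.length-tabulate {n = n} unbarred ,
    subst Unique (sym (Listₚ.map-tabulate {n = n} unbarred proj₁)) (Uniqueₚ.tabulate⁺ {A = Fin n} {n = n} {f = id} id)

  -- Left to unfold, this word would be normalised at every with-abstraction below.
  abstract
    vertex-ending : ∀ y → ∃[ x ] (Perm x × lst x ≡ y)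
    vertex-ending y with symbol-split {tabulate unbarred} some-perm (abs y)
    ... | u , a , z , eq , a≡ = go {turn u a z} (turn-perm u a z (subst Perm eq some-perm)) (sym a≡)
      where
      end : ∀ {x} → Perm x → hd x ≡ negate y → ∃[ x ] (Perm x × lst x ≡ y)
      end px h = _ , flip-perm px , trans (flip-lst px) (trans (cong negate h) (negate-involutive y))
      go : ∀ {x} → Perm x → abs y ≡ abs (hd x) → ∃[ x ] (Perm x × lst x ≡ y)
      go px eq with set-sign (negate y) px eq
      ... | inj₁ h                     = end px h
      ... | inj₂ (_ , (_ , pw , _) , h , _) = end pw h

  module Hubs (p : Fin n) (ℓ : V → Fin n) (hub : Fin n → SElt n)
              (hub-label : ∀ j → j ≢ p → ∀ x → lst x ≡ hub j → ℓ x ≡ j) where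

    -- Both ends keep the label, so the tree `j` may use such a step even when it meets `S`, without
    -- any arc.
    Own : Fin n → V → V → Set
    Own j x y = Perm x × Perm y × x ~ y × ℓ x ≡ j × ℓ y ≡ j

    root : Fin n → V
    root j = proj₁ (vertex-ending (hub j))

    root-perm : ∀ j → Perm (root j)
    root-perm j = proj₁ (proj₂ (vertex-ending (hub j)))

    root-lst : ∀ j → lst (root j) ≡ hub j
    root-lst j = proj₂ (proj₂ (vertex-ending (hub j)))

    root-label : ∀ j → j ≢ p → ℓ (root j) ≡ j
    root-label j j≢p = hub-label j j≢p (root j) (root-lst j)

    cluster⇒own : ∀ {j x y} → (∀ v → lst v ≡ lst x → ℓ v ≡ j) → Star _≈_ x y → Star (Own j) x y
    cluster⇒own f ε = ε
    cluster⇒own {x = x} f (_◅_ {j = w} (px , pw , a , l) st) =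
      (px , pw , a , f x refl , f w (sym l)) ◅ cluster⇒own (λ v eq → f v (trans eq (sym l))) st

    hub-walk : ∀ {j x} → j ≢ p → Perm x → lst x ≡ hub j → Star (Own j) x (root j)
    hub-walk {j} j≢p px l =
      cluster⇒own (λ v eq → hub-label j j≢p v (trans eq l)) (cluster-connected px (root-perm j) (trans l (sym (root-lst j))))

    -- Reversing the whole word moves the first symbol to the end with its sign changed; hence the
    -- `negate`.
    flip-hub : ∀ {j x} → j ≢ p → Perm x → ℓ x ≡ j → hd x ≡ negate (hub j) → Star (Own j) x (root j)
    flip-hub {j} {x} j≢p px ℓx h =
      (px , flip-perm px , flip-adj px , ℓx , hub-label j j≢p (flip x) l) ◅ hub-walk j≢p (flip-perm px) l
      where
      l : lst (flip x) ≡ hub j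
      l = trans (flip-lst px) (trans (cong negate h) (negate-involutive (hub j)))

  -- An explicit label of the cluster wins. The last symbol replaces a first symbol `p` because `p`
  -- has no tree.
  pick : Fin n → Maybe (Fin n) → Fin n → Fin n → Fin n
  pick p (just j) _ _ = j
  pick p nothing  h l with h Finₚ.≟ p
  ... | yes _ = l
  ... | no _  = h

  label : Fin n → (SElt n → Maybe (Fin n)) → V → Fin n
  label p kind x = pick p (kind (lst x)) (abs (hd x)) (abs (lst x))

  -- A word of S may use its edges to the words of S in its cluster, except to those paired with
  -- it in removed: in their place it uses flip x, which must carry the same label. If flip x is
  -- in S as well, this would make two claims on one edge unless only one word does so.
  record Plan (S : List V) : Set where
    field
      p          : Fin n
      kind       : SElt n → Maybe (Fin n)
      hub        : Fin n → SElt n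
      hub-abs    : ∀ j → abs (hub j) ≡ j
      hub-kind   : ∀ j → j ≢ p → kind (hub j) ≡ just j
      hub-p      : kind (hub p) ≡ nothing
      kind-just  : ∀ {y j} → kind y ≡ just j → j ≢ p × (y ≡ hub j ⊎ abs y ≢ j)
      S-perm     : ∀ {s} → s ∈ S → Perm s
      S-kind     : ∀ {s} → s ∈ S → kind (lst s) ≡ nothing
      special    : V
      removed    : List (V × V)

    ℓ : V → Fin n
    ℓ = label p kind

    field
      replaced   : ∀ {s t} → (s , t) ∈ removed → ℓ (flip s) ≡ ℓ t × (flip s ∉ S ⊎ s ≡ special)
      covered    : ∀ {s t} → s ∈ S → t ∈ S → s ~ t → lst s ≡ lst t → ℓ s ≢ ℓ t →
                   (s , t) ∈ removed ⊎ (t , s) ∈ removed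

  module _ {S : List V} (plan : Plan S) where
    open Plan plan

    private
      ℓ-kind : ∀ {j} x → kind (lst x) ≡ just j → ℓ x ≡ j
      ℓ-kind x eq rewrite eq = refl

      ℓ-first : ∀ x → kind (lst x) ≡ nothing → abs (hd x) ≢ p → ℓ x ≡ abs (hd x)
      ℓ-first x eq h≢ rewrite eq with abs (hd x) Finₚ.≟ p
      ... | yes h≡ = ⊥-elim (h≢ h≡)
      ... | no _   = refl

      ℓ-last : ∀ x → kind (lst x) ≡ nothing → abs (hd x) ≡ p → ℓ x ≡ abs (lst x)
      ℓ-last x eq h≡ rewrite eq with abs (hd x) Finₚ.≟ p
      ... | yes _ = refl
      ... | no h≢ = ⊥-elim (h≢ h≡)

      open Hubs p ℓ hub (λ j j≢p x l → ℓ-kind x (trans (cong kind l) (hub-kind j j≢p)))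

      -- A cluster given the label `j` as a whole is the hub itself, or its last symbol is not `j`;
      -- then `negate (hub j)` can be brought to the front without leaving the cluster, and one more
      -- reversal enters the hub.
      kind-walk : ∀ {j x} → Perm x → kind (lst x) ≡ just j → Star (Own j) x (root j)
      kind-walk {j} {x} px k with kind-just k
      ... | j≢p , inj₁ l = hub-walk j≢p px l
      ... | j≢p , inj₂ l≢ with steer (negate (hub j)) px (λ eq → l≢ (trans (sym eq) (hub-abs j)))
      ...   | y , st , py , h , l = cluster⇒own (λ v eq → ℓ-kind v (trans (cong kind eq) k)) st ◅◅ flip-hub j≢p py (ℓ-kind y (trans (cong kind l) k)) h

      first-walk : ∀ {x} → Perm x → kind (lst x) ≡ nothing → abs (hd x) ≢ p → Star (Own (abs (hd x))) x (root (abs (hd x)))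
      first-walk {x} px k h≢p with set-sign (negate (hub (abs (hd x)))) px (hub-abs (abs (hd x)))
      ... | inj₁ h = flip-hub h≢p px (ℓ-first x k h≢p) h
      ... | inj₂ (y , (_ , py , a , l) , h , _) =
        (px , py , a , ℓ-first x k h≢p , ℓy) ◅ flip-hub h≢p py ℓy h
        where
        h≡ : abs (hd y) ≡ abs (hd x)
        h≡ = trans (cong abs h) (hub-abs _)
        ℓy : ℓ y ≡ abs (hd x)
        ℓy = trans (ℓ-first y (trans (cong kind (sym l)) k) (λ eq → h≢p (trans (sym h≡) eq))) h≡

      -- The reversal enters the cluster `hub p`, which has no label of its own. There the former
      -- last symbol stands in front and yields the same label as before.
      cross : ∀ {y} → Perm y → kind (lst y) ≡ nothing → ∀ {j} → abs (lst y) ≡ j → abs (hd y) ≡ p → hd y ≡ negate (hub p) →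
              Star (Own j) y (root j)
      cross {y} py ky {j} refl hy≡p hy =
        (py , flip-perm py , flip-adj py , ℓ-last y ky hy≡p , trans (ℓ-first (flip y) kf hf≢) hf) ◅
        subst (λ i → Star (Own i) (flip y) (root i)) hf (first-walk (flip-perm py) kf hf≢)
        where
        kf : kind (lst (flip y)) ≡ nothing
        kf = trans (cong kind (trans (flip-lst py) (trans (cong negate hy) (negate-involutive (hub p))))) hub-p
        hf : abs (hd (flip y)) ≡ abs (lst y)
        hf = cong abs (flip-hd py)
        hf≢ : abs (hd (flip y)) ≢ p
        hf≢ eq = hd≢lst py (trans hy≡p (trans (sym eq) hf))

      last-walk : ∀ {x} → Perm x → kind (lst x) ≡ nothing → abs (hd x) ≡ p → Star (Own (abs (lst x))) x (root (abs (lst x)))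
      last-walk {x} px k h≡p with set-sign (negate (hub p)) px (trans (hub-abs p) (sym h≡p))
      ... | inj₁ h = cross px k refl h≡p h
      ... | inj₂ (y , (_ , py , a , l) , h , _) =
        (px , py , a , ℓ-last x k h≡p , trans (ℓ-last y ky hy) (cong abs (sym l))) ◅ cross py ky (cong abs (sym l)) hy h
        where
        ky : kind (lst y) ≡ nothing
        ky = trans (cong kind (sym l)) k
        hy : abs (hd y) ≡ p
        hy = trans (cong abs h) (hub-abs p)

      own-walk : ∀ {x} → Perm x → Star (Own (ℓ x)) x (root (ℓ x))
      own-walk {x} px with kind (lst x) in k
      ... | just j = kind-walk px k
      ... | nothing with abs (hd x) Finₚ.≟ p
      ...   | yes h≡ = last-walk px k h≡
      ...   | no h≢  = first-walk px k h≢

      -- The last symbol cannot be brought forward inside the cluster. If it is `j`, bringing `p`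
      -- forward instead gives a word labelled by its last symbol.
      neighbour : ∀ {s} j → Perm s → kind (lst s) ≡ nothing → j ≢ p → ∃[ v ] (s ≈ v × ℓ v ≡ j)
      neighbour {s} j ps ks j≢p with j Finₚ.≟ abs (lst s)
      ... | no j≢ with bring-hd ps j≢
      ...   | v , e@(_ , _ , _ , l) , h =
        v , e , trans (ℓ-first v (trans (cong kind (sym l)) ks) (λ eq → j≢p (trans (sym h) eq))) h
      neighbour {s} j ps ks j≢p | yes refl with bring-hd ps (j≢p ∘ sym)
      ... | v , e@(_ , _ , _ , l) , h =
        v , e , trans (ℓ-last v (trans (cong kind (sym l)) ks) h) (cong abs (sym l))

      open Dec∈ (_≟ʷ_ {n}) using (_∈?_)
      open Dec∈ (≡-dec (_≟ʷ_ {n}) (_≟ʷ_ {n})) using () renaming (_∈?_ to _∈²?_)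

      -- Only edges between vertices of `S` can be contested. Inside a cluster `removed` arbitrates;
      -- by reversing the whole word only `special` may step onto a vertex of `S`.
      Arc : V → V → Set
      Arc s v = v ∉ S ⊎ (lst s ≡ lst v × (s , v) ∉ removed) ⊎ (s ≡ special × v ≡ flip s)

      flip-lst≢ : ∀ {s} → Perm s → lst (flip s) ≢ lst s
      flip-lst≢ ps eq = hd≢lst ps (cong abs (trans (sym (flip-lst ps)) eq))

      one-way : ∀ {s t} → s ∈ S → t ∈ S → s ~ t → Arc s t → Arc t s → ℓ s ≡ ℓ t
      one-way s∈ t∈ a (inj₁ t∉) _ = ⊥-elim (t∉ t∈)
      one-way s∈ t∈ a _ (inj₁ s∉) = ⊥-elim (s∉ s∈)
      one-way {s} {t} s∈ t∈ a (inj₂ (inj₁ (l , ∉₁))) (inj₂ (inj₁ (_ , ∉₂))) with ℓ s Finₚ.≟ ℓ t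
      ... | yes eq = eq
      ... | no ℓ≢  = ⊥-elim ([ ∉₁ , ∉₂ ]′ (covered s∈ t∈ a l ℓ≢))
      one-way s∈ t∈ a (inj₂ (inj₁ (l , _))) (inj₂ (inj₂ (_ , s≡))) =
        ⊥-elim (flip-lst≢ (S-perm t∈) (trans (cong lst (sym s≡)) l))
      one-way s∈ t∈ a (inj₂ (inj₂ (_ , t≡))) (inj₂ (inj₁ (l , _))) =
        ⊥-elim (flip-lst≢ (S-perm s∈) (trans (cong lst (sym t≡)) l))
      -- Both ends would be `special`, whereas reversing the whole word changes the last symbol.
      one-way s∈ t∈ a (inj₂ (inj₂ (s≡ , _))) (inj₂ (inj₂ (t≡ , s≡ft))) =
        ⊥-elim (flip-lst≢ (S-perm t∈) (cong lst (trans (sym s≡ft) (trans s≡ (sym t≡)))))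

      open Link S ℓ Arc

      own⇒link : ∀ {j x y} → Own j x y → Link j x y
      own⇒link (px , py , a , ℓx , ℓy) = px , py , a , ℓy , inj₁ ℓx

      path-via : ∀ {s v j} → s ∈ S → s ~ v → Arc s v → ℓ v ≡ j → Star (Link j) s (root j)
      path-via s∈ a arc refl =
        (S-perm s∈ , pv , a , refl , inj₂ (s∈ , arc)) ◅ gmap id own⇒link (own-walk pv)
        where pv = adj-perm (S-perm s∈) a

      paths : ∀ {s} j → j ≢ p → s ∈ S → Star (Link j) s (root j)
      paths {s} j j≢p s∈ with neighbour j (S-perm s∈) (S-kind s∈) j≢p
      ... | v , (_ , _ , a , l) , ℓv with v ∈? S | (s , v) ∈²? removed
      ...   | no v∉ | _      = path-via s∈ a (inj₁ v∉) ℓv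
      ...   | yes _ | no r∉  = path-via s∈ a (inj₂ (inj₁ (l , r∉))) ℓv
      ...   | yes _ | yes r∈ with replaced r∈
      ...     | ℓ≡ , inj₁ f∉   = path-via s∈ (flip-adj (S-perm s∈)) (inj₁ f∉) (trans ℓ≡ ℓv)
      ...     | ℓ≡ , inj₂ s≡   = path-via s∈ (flip-adj (S-perm s∈)) (inj₂ (inj₂ (s≡ , refl))) (trans ℓ≡ ℓv)

    plan⇒family : Family (BP n) S (suc m)
    plan⇒family = assemble one-way root root-perm root-label paths

-- Labellings that settle rival claims

module Jokers (m : ℕ) where
  open Pancake m
  open Assembly m

  first-abs : V → Fin n
  first-abs x = abs (hd x)

  joker : V × V → SElt n
  joker (c , _) = negate (hd c)

  -- Two adjacent words of S with the same last symbol and different first symbols are rivals for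
  -- the edge between them. An entry (c , e) of jokers or naturals settles this: e may use the edge,
  -- while c reaches the label of e through flip c. For an entry of jokers the cluster of flip c is
  -- free of S and given the label of e as a whole; for an entry of naturals the word flip c has
  -- that label anyway.
  record Input (S : List V) : Set where
    field
      p         : Fin n
      special   : V
      jokers    : List (V × V)
      naturals  : List (V × V)

    Occupied : List (SElt n)
    Occupied = map lst S

    field
      S-perm    : ∀ {s} → s ∈ S → Perm s
      opposite  : ∀ {y} → y ∈ Occupied → negate y ∈ Occupied → abs y ≡ p
      joker-ok  : ∀ {c e} → (c , e) ∈ jokers →
                  c ∈ S × e ∈ S × lst c ≡ lst e × first-abs c ≢ first-abs e ×
                  negate (hd c) ∉ Occupied × (first-abs c ≢ p → hd c ∉ Occupied)
      distinct  : Unique (map (first-abs ∘ proj₁) jokers)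
      natural-ok : ∀ {c e} → (c , e) ∈ naturals →
                  c ∈ S × e ∈ S × lst c ≡ lst e × first-abs e ≡ p × negate (hd c) ∈ Occupied × c ≡ special
      covered   : ∀ {s t} → s ∈ S → t ∈ S → s ~ t → lst s ≡ lst t → first-abs s ≢ first-abs t →
                  (s , t) ∈ jokers ++ naturals ⊎ (t , s) ∈ jokers ++ naturals

  find : List (V × V) → SElt n → Maybe (V × V)
  find []      y = nothing
  find (e ∷ X) y with y ≟ₑ joker e
  ... | yes _ = just e
  ... | no _  = find X y

  find-just : ∀ X {y e} → find X y ≡ just e → e ∈ X × y ≡ joker e
  find-just (e ∷ X) {y} eq with y ≟ₑ joker e
  find-just (e ∷ X) refl | yes y≡ = here refl , y≡
  ... | no _ = let e∈ , y≡ = find-just X eq in there e∈ , y≡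

  find-nothing : ∀ X {y} → y ∉ map joker X → find X y ≡ nothing
  find-nothing []      y∉ = refl
  find-nothing (e ∷ X) {y} y∉ with y ≟ₑ joker e
  ... | yes y≡ = ⊥-elim (y∉ (here y≡))
  ... | no _   = find-nothing X (y∉ ∘ there)

  find-∈ : ∀ X {e} → Unique (map (first-abs ∘ proj₁) X) → e ∈ X → find X (joker e) ≡ just e
  find-∈ X {e} u e∈ with find X (joker e) in eq
  ... | just f  = let f∈ , y≡ = find-just X eq in
                  cong just (unique-∈ (first-abs ∘ proj₁) {x = X} u f∈ e∈ (cong abs (sym y≡)))
  ... | nothing = ⊥-elim (absent X e∈ eq)
    where
    absent : ∀ X {e} → e ∈ X → find X (joker e) ≢ nothing
    absent (e ∷ X) (here refl) eq with joker e ≟ₑ joker e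
    absent (e ∷ X) (here refl) () | yes _
    ... | no ¬refl = ¬refl refl
    absent (f ∷ X) {e} (there e∈) eq with joker e ≟ₑ joker f
    absent (f ∷ X) {e} (there e∈) () | yes _
    ... | no _ = absent X e∈ eq

  module _ {S : List V} (input : Input S) where
    open Input input

    private
      open Dec∈ (_≟ₑ_ {n}) using (_∈?_)

      -- The hub of `p` is only crossed by words keeping their labels, so it may meet S; it must
      -- still not be a joker, whose cluster has a foreign label.
      avoid : Fin n → List (SElt n)
      avoid j with j Finₚ.≟ p
      ... | yes _ = map joker jokers
      ... | no _  = Occupied ++ map joker jokers

      joker∈avoid : ∀ j {y} → y ∈ map joker jokers → y ∈ avoid j
      joker∈avoid j y∈ with j Finₚ.≟ p
      ... | yes _ = y∈
      ... | no _  = ∈ₚ.∈-++⁺ʳ Occupied y∈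

      occupied∈avoid : ∀ j {y} → j ≢ p → y ∈ Occupied → y ∈ avoid j
      occupied∈avoid j j≢p y∈ with j Finₚ.≟ p
      ... | yes j≡p = ⊥-elim (j≢p j≡p)
      ... | no _    = ∈ₚ.∈-++⁺ˡ y∈

      jokers-opposite : ∀ {y} → y ∈ map joker jokers → negate y ∈ map joker jokers → ⊥
      jokers-opposite {y} y∈ ny∈ with ∈ₚ.∈-map⁻ joker y∈ | ∈ₚ.∈-map⁻ joker ny∈
      ... | e , e∈ , refl | f , f∈ , ny≡ with unique-∈ (first-abs ∘ proj₁) {x = jokers} distinct e∈ f∈ (cong abs ny≡)
      ... | refl = negate-≢ (joker e) ny≡

      joker-occupied : ∀ {y} → y ∈ map joker jokers → y ∉ Occupied
      joker-occupied y∈ with ∈ₚ.∈-map⁻ joker y∈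
      ... | e , e∈ , refl = let _ , _ , _ , _ , ∉ , _ = joker-ok e∈ in ∉

      joker-opposite : ∀ {y} → abs y ≢ p → y ∈ map joker jokers → negate y ∉ Occupied
      joker-opposite y≢p y∈ with ∈ₚ.∈-map⁻ joker y∈
      ... | (c , _) , e∈ , refl = λ ny∈ → let _ , _ , _ , _ , _ , ∉ = joker-ok e∈ in
            ∉ y≢p (subst (λ a → a ∈ Occupied) (negate-involutive (hd c)) ny∈)

      -- A symbol could lose both signs to S, both to jokers, or one to each. These are excluded by
      -- `opposite`, by `distinct` and by the last clause of `joker-ok` respectively; for `p` only
      -- jokers count.
      not-both : ∀ j {y} → abs y ≡ j → y ∈ avoid j → negate y ∈ avoid j → ⊥
      not-both j {y} refl y∈ ny∈ with j Finₚ.≟ p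
      ... | yes _ = jokers-opposite y∈ ny∈
      ... | no j≢p with ∈ₚ.∈-++⁻ Occupied y∈ | ∈ₚ.∈-++⁻ Occupied ny∈
      ...   | inj₁ y∈O | inj₁ ny∈O = j≢p (opposite y∈O ny∈O)
      ...   | inj₁ y∈O | inj₂ ny∈J = joker-opposite j≢p ny∈J (subst (λ a → a ∈ Occupied) (sym (negate-involutive y)) y∈O)
      ...   | inj₂ y∈J | inj₁ ny∈O = joker-opposite j≢p y∈J ny∈O
      ...   | inj₂ y∈J | inj₂ ny∈J = jokers-opposite y∈J ny∈J

      hub : Fin n → SElt n
      hub j with (j , false) ∈? avoid j
      ... | yes _ = j , true
      ... | no _  = j , false

      hub-abs : ∀ j → abs (hub j) ≡ j
      hub-abs j with (j , false) ∈? avoid j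
      ... | yes _ = refl
      ... | no _  = refl

      hub∉avoid : ∀ j → hub j ∉ avoid j
      hub∉avoid j with (j , false) ∈? avoid j
      ... | yes f∈ = λ t∈ → not-both j refl f∈ t∈
      ... | no f∉  = f∉

      hub∉jokers : ∀ j → hub j ∉ map joker jokers
      hub∉jokers j = hub∉avoid j ∘ joker∈avoid j

      natural-label : V → Fin n
      natural-label x = pick p nothing (first-abs x) (abs (lst x))

      when : ∀ {P Q : Set} → Dec P → Dec Q → Fin n → Maybe (Fin n)
      when (no _) (yes _) j = just j
      when _      _       _ = nothing

      when-just : ∀ {P Q : Set} (P? : Dec P) (Q? : Dec Q) {i j} → when P? Q? i ≡ just j → ¬ P × Q × i ≡ j
      when-just (no ¬p) (yes q) refl = ¬p , q , refl
      when-just (no _)  (no _)  ()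
      when-just (yes _) _       ()

      when-nothing : ∀ {P Q : Set} (P? : Dec P) (Q? : Dec Q) {i} → (¬ P → ¬ Q) → when P? Q? i ≡ nothing
      when-nothing (no ¬p) (yes q) f = ⊥-elim (f ¬p q)
      when-nothing (no _)  (no _)  _ = refl
      when-nothing (yes _) _       _ = refl

      when-true : ∀ {P Q : Set} (P? : Dec P) (Q? : Dec Q) {i} → ¬ P → Q → when P? Q? i ≡ just i
      when-true (no _)  (yes _) _  _ = refl
      when-true (no _)  (no ¬q) _  q = ⊥-elim (¬q q)
      when-true (yes p) _       ¬p _ = ⊥-elim (¬p p)

      own-kind : SElt n → Maybe (Fin n)
      own-kind y = when (abs y Finₚ.≟ p) (y ≟ₑ hub (abs y)) (abs y)

      own-kind-just : ∀ {y j} → own-kind y ≡ just j → abs y ≢ p × y ≡ hub (abs y) × abs y ≡ j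
      own-kind-just {y} = when-just (abs y Finₚ.≟ p) (y ≟ₑ hub (abs y))

      own-kind-nothing : ∀ {y} → (abs y ≢ p → y ≢ hub (abs y)) → own-kind y ≡ nothing
      own-kind-nothing {y} = when-nothing (abs y Finₚ.≟ p) (y ≟ₑ hub (abs y))

      own-kind-hub : ∀ j → j ≢ p → own-kind (hub j) ≡ just j
      own-kind-hub j j≢p = trans
        (when-true (abs (hub j) Finₚ.≟ p) (hub j ≟ₑ hub (abs (hub j)))
                   (λ h≡ → j≢p (trans (sym (hub-abs j)) h≡)) (cong hub (sym (hub-abs j))))
        (cong just (hub-abs j))

      kind : SElt n → Maybe (Fin n)
      kind y with find jokers y
      ... | just (_ , e) = just (natural-label e)
      ... | nothing      = own-kind y

      kind-own : ∀ {y} → y ∉ map joker jokers → kind y ≡ own-kind y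
      kind-own y∉ rewrite find-nothing jokers y∉ = refl

      kind-joker : ∀ {c e} → (c , e) ∈ jokers → kind (negate (hd c)) ≡ just (natural-label e)
      kind-joker e∈ rewrite find-∈ jokers distinct e∈ = refl

      kind-just : ∀ {y j} → kind y ≡ just j → j ≢ p × (y ≡ hub j ⊎ abs y ≢ j)
      kind-just {y} eq with find jokers y in found
      kind-just {y} eq | nothing with own-kind-just eq
      ... | y≢p , y≡ , refl = y≢p , inj₁ y≡
      kind-just {y} eq | just (c , e) with find-just jokers found
      ... | e∈ , refl with joker-ok e∈
      ...   | c∈S , e∈S , l , h≢ , _ with first-abs e Finₚ.≟ p
      kind-just {y} refl | just (c , e) | e∈ , refl | c∈S , e∈S , l , h≢ , _ | no e≢p = e≢p , inj₂ h≢
      -- Here `e` is labelled by its last symbol. This is not `p`, with which `e` begins, and as it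
      -- is also the last symbol of `c` it is not the first symbol of `c`.
      kind-just {y} refl | just (c , e) | e∈ , refl | c∈S , e∈S , l , h≢ , _ | yes refl =
        (λ eq → hd≢lst (S-perm e∈S) (sym eq)) , inj₂ (λ eq → hd≢lst (S-perm c∈S) (trans eq (cong abs (sym l))))

      occupied-kind : ∀ {y} → y ∈ Occupied → kind y ≡ nothing
      occupied-kind {y} y∈ = trans (kind-own (λ y∈J → joker-occupied y∈J y∈))
        (own-kind-nothing (λ y≢p y≡ → hub∉avoid (abs y) (occupied∈avoid (abs y) y≢p (subst (λ a → a ∈ Occupied) y≡ y∈))))

      S-kind : ∀ {s} → s ∈ S → kind (lst s) ≡ nothing
      S-kind s∈ = occupied-kind (∈ₚ.∈-map⁺ lst s∈)

      ℓ : V → Fin n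
      ℓ = label p kind

      ℓ-kind : ∀ x {k} → kind (lst x) ≡ k → ℓ x ≡ pick p k (first-abs x) (abs (lst x))
      ℓ-kind x eq = cong (λ k → pick p k (first-abs x) (abs (lst x))) eq

      pick-first : ∀ {h l} → h ≢ p → pick p nothing h l ≡ h
      pick-first {h} h≢ with h Finₚ.≟ p
      ... | yes h≡ = ⊥-elim (h≢ h≡)
      ... | no _   = refl

      pick-last : ∀ {h l} → h ≡ p → pick p nothing h l ≡ l
      pick-last {h} h≡ with h Finₚ.≟ p
      ... | yes _ = refl
      ... | no h≢ = ⊥-elim (h≢ h≡)

      replaced : ∀ {s t} → (s , t) ∈ jokers ++ naturals → ℓ (flip s) ≡ ℓ t × (flip s ∉ S ⊎ s ≡ special)
      replaced {s} {t} st∈ with ∈ₚ.∈-++⁻ jokers st∈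
      ... | inj₁ st∈J = let s∈ , t∈ , _ = joker-ok st∈J
                            k = trans (cong kind (flip-lst (S-perm s∈))) (kind-joker st∈J) in
        trans (ℓ-kind (flip s) k) (sym (ℓ-kind t (S-kind t∈))) ,
        inj₁ (λ f∈ → case trans (sym (S-kind f∈)) k of λ ())
      -- The word `flip s` begins with the last symbol of `s`, which is also that of `t`; this is
      -- the label of `t` because `t` begins with `p`.
      ... | inj₂ st∈N = let s∈ , t∈ , l , t≡p , o∈ , s≡ = natural-ok st∈N
                            k = trans (cong kind (flip-lst (S-perm s∈))) (occupied-kind o∈)
                            h = cong abs (flip-hd (S-perm s∈)) in
        trans (ℓ-kind (flip s) k)
          (trans (pick-first (λ eq → hd≢lst (S-perm t∈) (trans t≡p (trans (sym eq) (trans h (cong abs l))))))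
            (trans h (trans (cong abs l) (sym (trans (ℓ-kind t (S-kind t∈)) (pick-last t≡p)))))) ,
        inj₂ s≡

    plan : Plan S
    plan = record
      { p = p ; kind = kind ; hub = hub ; hub-abs = hub-abs
      ; hub-kind = λ j j≢p → trans (kind-own (hub∉jokers j)) (own-kind-hub j j≢p)
      ; hub-p = trans (kind-own (hub∉jokers p)) (own-kind-nothing (λ h≢ → ⊥-elim (h≢ (hub-abs p))))
      ; kind-just = kind-just ; S-perm = S-perm ; S-kind = S-kind
      ; special = special ; removed = jokers ++ naturals ; replaced = replaced
      ; covered = λ {s} {t} s∈ t∈ a l ℓ≢ → covered s∈ t∈ a l (λ h≡ → ℓ≢
          (cong₂ (λ h l → pick p (kind l) h (abs l)) h≡ l))
      }

    input⇒family : Family (BP n) S (suc m)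
    input⇒family = plan⇒family plan

-- Rivals among four vertices

module Cases (m : ℕ) where
  open Pancake m
  open Jokers m

  adj? : ∀ x y → Dec (x ~ y)
  adj? x y = map′ to from (Finₚ.any? (λ (k : Fin n) → y ≟ʷ prefixRev x (suc (toℕ k))))
    where
    to : (∃[ k ] y ≡ prefixRev x (suc (toℕ {n} k))) → x ~ y
    to (k , eq) = suc (toℕ k) , s≤s z≤n , Finₚ.toℕ<n k , eq
    from : x ~ y → ∃[ k ] y ≡ prefixRev x (suc (toℕ {n} k))
    from (suc i , _ , i< , eq) = fromℕ< i< , trans eq (cong (λ j → prefixRev x (suc j)) (sym (Finₚ.toℕ-fromℕ< i<)))

  Rival : V → V → Set
  Rival x y = x ~ y × lst x ≡ lst y × first-abs x ≢ first-abs y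

  rival? : ∀ x y → Dec (Rival x y)
  rival? x y = adj? x y ×-dec ((lst x ≟ₑ lst y) ×-dec ¬? (first-abs x Finₚ.≟ first-abs y))

  rival-sym : ∀ {x y} → Perm x → Rival x y → Rival y x
  rival-sym px (a , l , h) = adj-sym px a , sym l , h ∘ sym

  rival-distinct : ∀ {x y z} → Perm x → Rival x y → Rival x z → y ≢ z → first-abs y ≢ first-abs z
  rival-distinct px (a , _) (b , _) y≢z h = y≢z (neighbours-hd px a b h)

  no-rival-triangle : ∀ {x y z} → Perm x → Rival x y → Rival x z → ¬ Rival y z
  no-rival-triangle px (a , _ , h) (b , _) (c , _) = no-triangle px a b c (λ { refl → h refl })

  first≢last : ∀ {x y} → Perm x → lst y ≡ lst x → first-abs x ≢ abs (lst y)
  first≢last px l h = hd≢lst px (trans h (cong abs l))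

  Good : V → V → V → V → Set
  Good s t u w = Family (BP n) (s ∷ t ∷ u ∷ w ∷ []) (suc m)

  Perms : V → V → V → V → Set
  Perms s t u w = Perm s × Perm t × Perm u × Perm w

  swap-st : ∀ {s t u w} → Good t s u w → Good s t u w
  swap-st = family-⊆ inc inc
    where
    inc : ∀ {a b c d : V} → a ∷ b ∷ c ∷ d ∷ [] ⊆ b ∷ a ∷ c ∷ d ∷ []
    inc (here eq)          = there (here eq)
    inc (there (here eq))  = here eq
    inc (there (there x∈)) = there (there x∈)

  swap-uw : ∀ {s t u w} → Good s t w u → Good s t u w
  swap-uw = family-⊆ inc inc
    where
    inc : ∀ {a b c d : V} → a ∷ b ∷ c ∷ d ∷ [] ⊆ a ∷ b ∷ d ∷ c ∷ []
    inc (here eq)                         = here eq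
    inc (there (here eq))                 = there (here eq)
    inc (there (there (here eq)))         = there (there (there (here eq)))
    inc (there (there (there (here eq)))) = there (there (here eq))

  swap-tu : ∀ {s t u w} → Good s u t w → Good s t u w
  swap-tu = family-⊆ inc inc
    where
    inc : ∀ {a b c d : V} → a ∷ b ∷ c ∷ d ∷ [] ⊆ a ∷ c ∷ b ∷ d ∷ []
    inc (here eq)                 = here eq
    inc (there (here eq))         = there (there (here eq))
    inc (there (there (here eq))) = there (here eq)
    inc (there (there (there x∈))) = there (there (there x∈))

  module Four (s t u w : V) (perms : Perms s t u w) where
    S : List V
    S = s ∷ t ∷ u ∷ w ∷ []

    Occupied : List (SElt n)
    Occupied = map lst S

    s∈ : s ∈ S
    s∈ = here refl
    t∈ : t ∈ S
    t∈ = there (here refl)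
    u∈ : u ∈ S
    u∈ = there (there (here refl))
    w∈ : w ∈ S
    w∈ = there (there (there (here refl)))

    each : (P : V → Set) → P s → P t → P u → P w → ∀ {x} → x ∈ S → P x
    each P ps pt pu pw (here refl)                         = ps
    each P ps pt pu pw (there (here refl))                 = pt
    each P ps pt pu pw (there (there (here refl)))         = pu
    each P ps pt pu pw (there (there (there (here refl)))) = pw

    S-perm : ∀ {x} → x ∈ S → Perm x
    S-perm = let ps , pt , pu , pw = perms in each Perm ps pt pu pw

    occupied : (P : SElt n → Set) → P (lst s) → P (lst t) → P (lst u) → P (lst w) → ∀ {y} → y ∈ Occupied → P y
    occupied P ps pt pu pw y∈ with ∈ₚ.∈-map⁻ lst y∈
    ... | x , x∈ , refl = each (P ∘ lst) ps pt pu pw x∈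

    Entry : Fin n → V × V → Set
    Entry p (c , e) = c ∈ S × e ∈ S × lst c ≡ lst e × first-abs c ≢ first-abs e ×
                      negate (hd c) ∉ Occupied × (first-abs c ≢ p → hd c ∉ Occupied)

    Covers : List (V × V) → V → V → Set
    Covers X x y = Rival x y → (x , y) ∈ X ⊎ (y , x) ∈ X

    covers-all : ∀ X → Covers X s t → Covers X s u → Covers X s w → Covers X t u → Covers X t w → Covers X u w →
                 ∀ {x y} → x ∈ S → y ∈ S → x ~ y → lst x ≡ lst y → first-abs x ≢ first-abs y →
                 (x , y) ∈ X ⊎ (y , x) ∈ X
    covers-all X st su sw tu tw uw {x} {y} x∈ y∈ a l h = go x∈ y∈ (a , l , h)
      where
      same : ∀ {x} → Covers X x x
      same (_ , _ , h) = ⊥-elim (h refl)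
      back : ∀ {x y} → y ∈ S → Covers X x y → Covers X y x
      back y∈ c b with c (rival-sym (S-perm y∈) b)
      ... | inj₁ m = inj₂ m
      ... | inj₂ m = inj₁ m
      go : ∀ {x y} → x ∈ S → y ∈ S → Covers X x y
      go {y = y} x∈ = each (λ x → ∀ {y} → y ∈ S → Covers X x y)
        (each (Covers X s) same st su sw) (each (Covers X t) (back t∈ st) same tu tw)
        (each (Covers X u) (back u∈ su) (back u∈ tu) same uw)
        (each (Covers X w) (back w∈ sw) (back w∈ tw) (back w∈ uw) same) x∈

    Free : V → Set
    Free c = ∀ {x} → x ∈ S → first-abs c ≢ abs (lst x)

    -- When neither cluster of the first symbol of `c` meets S, both conditions on occupied clusters
    -- hold, for any `p`.
    free-entry : ∀ {p c e} → c ∈ S → e ∈ S → Rival c e → Free c → Entry p (c , e)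
    free-entry {c = c} c∈ e∈ (_ , l , h) free = c∈ , e∈ , l , h , absent refl , λ _ → absent refl
      where
      absent : ∀ {y} → first-abs c ≡ abs y → y ∉ Occupied
      absent h y∈ with ∈ₚ.∈-map⁻ lst y∈
      ... | x , x∈ , refl = free x∈ h

    -- Taking `p` to be the first symbol of `c` empties the last condition: that symbol needs no hub
    -- off S, so only the cluster of `flip c` has to be free.
    main-entry : ∀ {p c e} → c ∈ S → e ∈ S → Rival c e → first-abs c ≡ p → negate (hd c) ∉ Occupied → Entry p (c , e)
    main-entry c∈ e∈ (_ , l , h) h≡p ∉ = c∈ , e∈ , l , h , ∉ , λ h≢p → ⊥-elim (h≢p h≡p)

    Opposite : Fin n → Set
    Opposite p = ∀ {y} → y ∈ Occupied → negate y ∈ Occupied → abs y ≡ p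

    -- Apart from `p` a single signed symbol is left, and it is not its own opposite.
    opposite-except : ∀ {p} c → (∀ {y} → y ∈ Occupied → abs y ≡ p ⊎ y ≡ c) → Opposite p
    opposite-except c f {y} y∈ ny∈ with f y∈ | f ny∈
    ... | inj₁ eq | _       = eq
    ... | inj₂ _  | inj₁ eq = eq
    ... | inj₂ eq | inj₂ eq′ = ⊥-elim (negate-≢ y (trans eq′ (sym eq)))

    opposite-injective : ∀ {p} → (∀ {y z} → y ∈ Occupied → z ∈ Occupied → abs y ≡ abs z → y ≡ z) → Opposite p
    opposite-injective f {y} y∈ ny∈ = ⊥-elim (negate-≢ y (f ny∈ y∈ refl))

    build : ∀ p X → Opposite p → All (Entry p) X → Unique (map (first-abs ∘ proj₁) X) →
            Covers X s t → Covers X s u → Covers X s w → Covers X t u → Covers X t w → Covers X u w → Good s t u w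
    build p X opp entries unique st su sw tu tw uw = input⇒family (record
      { p = p ; special = s ; jokers = X ; naturals = [] ; S-perm = S-perm ; opposite = opp
      ; joker-ok = All.lookup entries ; distinct = unique ; natural-ok = λ ()
      ; covered = subst (λ Y → ∀ {x y} → x ∈ S → y ∈ S → x ~ y → lst x ≡ lst y → first-abs x ≢ first-abs y →
                               (x , y) ∈ Y ⊎ (y , x) ∈ Y)
                        (sym (Listₚ.++-identityʳ X)) (covers-all X st su sw tu tw uw) })

    build-natural : ∀ p X c e → Opposite p → All (Entry p) X → Unique (map (first-abs ∘ proj₁) X) →
            c ∈ S → e ∈ S → Rival c e → first-abs e ≡ p → negate (hd c) ∈ Occupied →
            (let Y = X ++ (c , e) ∷ [] in
             Covers Y s t → Covers Y s u → Covers Y s w → Covers Y t u → Covers Y t w → Covers Y u w → Good s t u w)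
    build-natural p X c e opp entries unique c∈ e∈ (_ , l , _) e≡p o∈ st su sw tu tw uw = input⇒family (record
      { p = p ; special = c ; jokers = X ; naturals = (c , e) ∷ [] ; S-perm = S-perm ; opposite = opp
      ; joker-ok = All.lookup entries ; distinct = unique
      ; natural-ok = λ { (here refl) → c∈ , e∈ , l , e≡p , o∈ , refl }
      ; covered = covers-all _ st su sw tu tw uw })

  none : ∀ {x y X} → ¬ Rival x y → Rival x y → (x , y) ∈ X ⊎ (y , x) ∈ X
  none ¬b b = ⊥-elim (¬b b)

  apart : ∀ {x y X} → lst x ≢ lst y → Rival x y → (x , y) ∈ X ⊎ (y , x) ∈ X
  apart l≢ (_ , l , _) = ⊥-elim (l≢ l)

  unique₁ : ∀ {A : Set} {a : A} → Unique (a ∷ [])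
  unique₁ = [] ∷ []
  unique₂ : ∀ {A : Set} {a b : A} → a ≢ b → Unique (a ∷ b ∷ [])
  unique₂ ab = (ab ∷ []) ∷ unique₁
  unique₃ : ∀ {A : Set} {a b c : A} → a ≢ b → a ≢ c → b ≢ c → Unique (a ∷ b ∷ c ∷ [])
  unique₃ ab ac bc = (ab ∷ ac ∷ []) ∷ unique₂ bc
  unique₄ : ∀ {A : Set} {a b c d : A} → a ≢ b → a ≢ c → a ≢ d → b ≢ c → b ≢ d → c ≢ d → Unique (a ∷ b ∷ c ∷ d ∷ [])
  unique₄ ab ac ad bc bd cd = (ab ∷ ac ∷ ad ∷ []) ∷ unique₃ bc bd cd

  pattern at₀ = here refl
  pattern at₁ = there (here refl)
  pattern at₂ = there (there (here refl))
  pattern at₃ = there (there (there (here refl)))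

  -- Four vertices in one cluster

  module OneCluster where

    Together : V → V → V → V → Set
    Together s t u w = lst t ≡ lst s × lst u ≡ lst s × lst w ≡ lst s

    module _ (s t u w : V) (perms : Perms s t u w) (tog : Together s t u w) where
      open Four s t u w perms

      private
        same : ∀ {x} → x ∈ S → lst x ≡ lst s
        same = let lt , lu , lw = tog in each (λ x → lst x ≡ lst s) refl lt lu lw

        opp : Opposite (abs (lst s))
        opp y∈ _ with ∈ₚ.∈-map⁻ lst y∈
        ... | x , x∈ , refl = cong abs (same x∈)

        free : ∀ {c} → c ∈ S → Free c
        free c∈ {x} x∈ = first≢last {y = x} (S-perm c∈) (trans (same x∈) (sym (same c∈)))

      entry : ∀ {c e} → c ∈ S → e ∈ S → Rival c e → Entry (abs (lst s)) (c , e)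
      entry c∈ e∈ b = free-entry c∈ e∈ b (free c∈)

      build-one : ∀ X → All (Entry (abs (lst s))) X → Unique (map (first-abs ∘ proj₁) X) →
            Covers X s t → Covers X s u → Covers X s w → Covers X t u → Covers X t w → Covers X u w → Good s t u w
      build-one X = build (abs (lst s)) X opp

    -- The graph of rivals has no triangle, and the rivals of a word differ in first-abs. So its edges
    -- can be charged to distinct endpoints that differ in first-abs.
    path-or-more : ∀ s t u w → Perms s t u w → Unique (s ∷ t ∷ u ∷ w ∷ []) → Together s t u w →
                   Rival s t → Rival s u → Good s t u w
    path-or-more s t u w P@(ps , pt , pu , pw) ((s≢t ∷ s≢u ∷ s≢w ∷ []) ∷ (t≢u ∷ t≢w ∷ []) ∷ (u≢w ∷ []) ∷ _) T st su =
      go (rival? s w) (rival? t w) (rival? u w)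
      where
      open Four s t u w P
      E : ∀ {c e} → c ∈ S → e ∈ S → Rival c e → Entry (abs (lst s)) (c , e)
      E = entry s t u w P T
      B : _
      B = build-one s t u w P T
      ts = rival-sym ps st
      us = rival-sym ps su
      ¬tu = no-rival-triangle ps st su
      t≠u = rival-distinct ps st su t≢u
      s≠t = proj₂ (proj₂ st)
      s≠u = proj₂ (proj₂ su)
      go : Dec (Rival s w) → Dec (Rival t w) → Dec (Rival u w) → Good s t u w
      go (yes sw) _ _ = B ((t , s) ∷ (u , s) ∷ (w , s) ∷ [])
        (E t∈ s∈ ts ∷ E u∈ s∈ us ∷ E w∈ s∈ (rival-sym ps sw) ∷ [])
        (unique₃ t≠u (rival-distinct ps st sw t≢w) (rival-distinct ps su sw u≢w))
        (λ _ → inj₂ at₀) (λ _ → inj₂ at₁) (λ _ → inj₂ at₂) (none ¬tu)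
        (none (no-rival-triangle ps st sw)) (none (no-rival-triangle ps su sw))
      go (no ¬sw) (no ¬tw) (no ¬uw) = B ((t , s) ∷ (u , s) ∷ [])
        (E t∈ s∈ ts ∷ E u∈ s∈ us ∷ []) (unique₂ t≠u)
        (λ _ → inj₂ at₀) (λ _ → inj₂ at₁) (none ¬sw) (none ¬tu) (none ¬tw) (none ¬uw)
      go (no ¬sw) (no ¬tw) (yes uw) = B ((t , s) ∷ (s , u) ∷ (u , w) ∷ [])
        (E t∈ s∈ ts ∷ E s∈ u∈ su ∷ E u∈ w∈ uw ∷ []) (unique₃ (s≠t ∘ sym) t≠u s≠u)
        (λ _ → inj₂ at₀) (λ _ → inj₁ at₁) (none ¬sw) (none ¬tu) (none ¬tw) (λ _ → inj₁ at₂)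
      go (no ¬sw) (yes tw) (no ¬uw) = B ((u , s) ∷ (s , t) ∷ (t , w) ∷ [])
        (E u∈ s∈ us ∷ E s∈ t∈ st ∷ E t∈ w∈ tw ∷ []) (unique₃ (s≠u ∘ sym) (t≠u ∘ sym) s≠t)
        (λ _ → inj₁ at₁) (λ _ → inj₂ at₀) (none ¬sw) (none ¬tu) (λ _ → inj₁ at₂) (none ¬uw)
      -- A cycle s, t, w, u: each edge is charged to its earlier end. Neighbours on the cycle are
      -- rivals and opposite corners have a common rival, so all four first symbols differ.
      go (no ¬sw) (yes tw) (yes uw) = B ((s , t) ∷ (t , w) ∷ (w , u) ∷ (u , s) ∷ [])
        (E s∈ t∈ st ∷ E t∈ w∈ tw ∷ E w∈ u∈ (rival-sym pu uw) ∷ E u∈ s∈ us ∷ [])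
        (unique₄ s≠t (rival-distinct pt ts tw s≢w) s≠u (proj₂ (proj₂ tw)) t≠u (proj₂ (proj₂ uw) ∘ sym))
        (λ _ → inj₁ at₀) (λ _ → inj₂ at₃) (none ¬sw) (none ¬tu) (λ _ → inj₁ at₁) (λ _ → inj₂ at₂)

    good : ∀ s t u w → Perms s t u w → Unique (s ∷ t ∷ u ∷ w ∷ []) → Together s t u w → Rival s t → Good s t u w
    good s t u w P@(ps , pt , pu , pw) U@((s≢t ∷ s≢u ∷ s≢w ∷ []) ∷ (t≢u ∷ t≢w ∷ []) ∷ (u≢w ∷ []) ∷ _) T@(lt , lu , lw) st =
      go (rival? s u) (rival? t u) (rival? s w) (rival? t w) (rival? u w)
      where
      open Four s t u w P
      E : ∀ {c e} → c ∈ S → e ∈ S → Rival c e → Entry (abs (lst s)) (c , e)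
      E = entry s t u w P T
      B : _
      B = build-one s t u w P T
      ts = rival-sym ps st
      Ut : Unique (t ∷ s ∷ u ∷ w ∷ [])
      Ut = unique₄ (s≢t ∘ sym) t≢u t≢w s≢u s≢w u≢w
      Uw : Unique (s ∷ t ∷ w ∷ u ∷ [])
      Uw = unique₄ s≢t s≢w s≢u t≢w t≢u (u≢w ∘ sym)
      Utw : Unique (t ∷ s ∷ w ∷ u ∷ [])
      Utw = unique₄ (s≢t ∘ sym) t≢w t≢u s≢w s≢u (u≢w ∘ sym)
      Tt : Together t s u w
      Tt = sym lt , trans lu (sym lt) , trans lw (sym lt)
      go : Dec (Rival s u) → Dec (Rival t u) → Dec (Rival s w) → Dec (Rival t w) → Dec (Rival u w) → Good s t u w
      go (yes su) _ _ _ _ = path-or-more s t u w P U T st su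
      go (no _) (yes tu) _ _ _ = swap-st (path-or-more t s u w (pt , ps , pu , pw) Ut Tt ts tu)
      go (no _) (no _) (yes sw) _ _ = swap-uw (path-or-more s t w u (ps , pt , pw , pu) Uw (lt , lw , lu) st sw)
      go (no _) (no _) (no _) (yes tw) _ = swap-st (swap-uw (path-or-more t s w u (pt , ps , pw , pu) Utw
        (proj₁ Tt , proj₂ (proj₂ Tt) , proj₁ (proj₂ Tt)) ts tw))
      go (no ¬su) (no ¬tu) (no ¬sw) (no ¬tw) (no ¬uw) = B ((s , t) ∷ []) (E s∈ t∈ st ∷ []) unique₁
        (λ _ → inj₁ at₀) (none ¬su) (none ¬sw) (none ¬tu) (none ¬tw) (none ¬uw)
      go (no ¬su) (no ¬tu) (no ¬sw) (no ¬tw) (yes uw) with first-abs s Finₚ.≟ first-abs u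
      ... | no s≠u = B ((s , t) ∷ (u , w) ∷ []) (E s∈ t∈ st ∷ E u∈ w∈ uw ∷ []) (unique₂ s≠u)
        (λ _ → inj₁ at₀) (none ¬su) (none ¬sw) (none ¬tu) (none ¬tw) (λ _ → inj₁ at₁)
      -- Rivals begin differently, so `t` can pay in place of `s`.
      ... | yes s=u = B ((t , s) ∷ (u , w) ∷ []) (E t∈ s∈ ts ∷ E u∈ w∈ uw ∷ [])
        (unique₂ (λ t=u → proj₂ (proj₂ st) (trans s=u (sym t=u))))
        (λ _ → inj₂ at₀) (none ¬su) (none ¬sw) (none ¬tu) (none ¬tw) (λ _ → inj₁ at₁)

  -- Three vertices in one cluster and one elsewhere

  module ThreeAndOne where

    Split : V → V → V → V → Set
    Split s t u w = lst t ≡ lst s × lst u ≡ lst s × lst w ≢ lst s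

    module _ (s t u w : V) (perms : Perms s t u w) (split : Split s t u w) where
      open Four s t u w perms

      private
        last-cases : (P : SElt n → Set) → P (lst s) → P (lst w) → ∀ {x} → x ∈ S → P (lst x)
        last-cases P p q = let lt , lu , _ = split in
          each (P ∘ lst) p (subst P (sym lt) p) (subst P (sym lu) p) q

        opp : Opposite (abs (lst s))
        opp = opposite-except (lst w) λ y∈ → cases y∈
          where
          cases : ∀ {y} → y ∈ Occupied → abs y ≡ abs (lst s) ⊎ y ≡ lst w
          cases y∈ with ∈ₚ.∈-map⁻ lst y∈
          ... | x , x∈ , refl = last-cases (λ y → abs y ≡ abs (lst s) ⊎ y ≡ lst w) (inj₁ refl) (inj₂ refl) x∈

      entry : ∀ {c e} → c ∈ S → e ∈ S → lst c ≡ lst s → Rival c e → first-abs c ≢ abs (lst w) → Entry (abs (lst s)) (c , e)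
      entry {c} c∈ e∈ l b c≢ = free-entry c∈ e∈ b (last-cases (λ y → first-abs c ≢ abs y)
        (first≢last {y = s} (S-perm c∈) (sym l)) c≢)

      build-three : ∀ X → All (Entry (abs (lst s))) X → Unique (map (first-abs ∘ proj₁) X) →
            Covers X s t → Covers X s u → Covers X t u → Good s t u w
      build-three X es un st su tu = let lt , lu , lw = split in
        build (abs (lst s)) X opp es un st su (apart (lw ∘ sym)) tu
              (apart (λ eq → lw (trans (sym eq) lt))) (apart (λ eq → lw (trans (sym eq) lu)))

    -- An endpoint may give way unless it begins with the last symbol of `w`. Since `t` and `u`
    -- begin differently, at most one of them is barred, and then `s` gives way on that edge.
    path : ∀ s t u w → Perms s t u w → t ≢ u → Split s t u w → Rival s t → Rival s u → Good s t u w
    path s t u w P@(ps , pt , pu , pw) t≢u T@(lt , lu , lw) st su =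
      go (first-abs t Finₚ.≟ abs (lst w)) (first-abs u Finₚ.≟ abs (lst w))
      where
      open Four s t u w P
      E : ∀ {c e} → c ∈ S → e ∈ S → lst c ≡ lst s → Rival c e → first-abs c ≢ abs (lst w) → Entry (abs (lst s)) (c , e)
      E = entry s t u w P T
      ts = rival-sym ps st
      us = rival-sym ps su
      ¬tu = no-rival-triangle ps st su
      t≠u = rival-distinct ps st su t≢u
      s≠t = proj₂ (proj₂ st)
      s≠u = proj₂ (proj₂ su)
      go : Dec (first-abs t ≡ abs (lst w)) → Dec (first-abs u ≡ abs (lst w)) → Good s t u w
      go (yes t=w) _ = build-three s t u w P T ((s , t) ∷ (u , s) ∷ [])
        (E s∈ t∈ refl st (λ s=w → s≠t (trans s=w (sym t=w))) ∷ E u∈ s∈ lu us (λ u=w → t≠u (trans t=w (sym u=w))) ∷ [])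
        (unique₂ s≠u) (λ _ → inj₁ at₀) (λ _ → inj₂ at₁) (none ¬tu)
      go (no t≠w) (yes u=w) = build-three s t u w P T ((t , s) ∷ (s , u) ∷ [])
        (E t∈ s∈ lt ts t≠w ∷ E s∈ u∈ refl su (λ s=w → s≠u (trans s=w (sym u=w))) ∷ [])
        (unique₂ (s≠t ∘ sym)) (λ _ → inj₂ at₀) (λ _ → inj₁ at₁) (none ¬tu)
      go (no t≠w) (no u≠w) = build-three s t u w P T ((t , s) ∷ (u , s) ∷ [])
        (E t∈ s∈ lt ts t≠w ∷ E u∈ s∈ lu us u≠w ∷ [])
        (unique₂ t≠u) (λ _ → inj₂ at₀) (λ _ → inj₂ at₁) (none ¬tu)

    good : ∀ s t u w → Perms s t u w → s ≢ u → t ≢ u → Split s t u w → Rival s t → Good s t u w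
    good s t u w P@(ps , pt , pu , pw) s≢u t≢u T@(lt , lu , lw) st =
      go (rival? s u) (rival? t u) (first-abs s Finₚ.≟ abs (lst w))
      where
      open Four s t u w P
      ts = rival-sym ps st
      go : Dec (Rival s u) → Dec (Rival t u) → Dec (first-abs s ≡ abs (lst w)) → Good s t u w
      go (yes su) _ _ = path s t u w P t≢u T st su
      go (no _) (yes tu) _ = swap-st (path t s u w (pt , ps , pu , pw) s≢u
        (sym lt , trans lu (sym lt) , λ eq → lw (trans eq lt)) ts tu)
      go (no ¬su) (no ¬tu) (no s≠w) = build-three s t u w P T ((s , t) ∷ [])
        (entry s t u w P T s∈ t∈ refl st s≠w ∷ []) unique₁ (λ _ → inj₁ at₀) (none ¬su) (none ¬tu)
      go (no ¬su) (no ¬tu) (yes s=w) = build-three s t u w P T ((t , s) ∷ [])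
        (entry s t u w P T t∈ s∈ lt ts (λ t=w → proj₂ (proj₂ st) (trans s=w (sym t=w))) ∷ []) unique₁
        (λ _ → inj₂ at₀) (none ¬su) (none ¬tu)

  -- Two rival pairs in different clusters

  module TwoPairs where

    Split : V → V → V → V → Set
    Split s t u w = Rival s t × Rival u w × lst u ≢ lst s

    module _ (s t u w : V) (perms : Perms s t u w) (split : Split s t u w) where
      open Four s t u w perms

      private
        st = proj₁ split
        uw = proj₁ (proj₂ split)
        l≢ = proj₂ (proj₂ split)
        lt : lst t ≡ lst s
        lt = sym (proj₁ (proj₂ st))
        lw : lst w ≡ lst u
        lw = sym (proj₁ (proj₂ uw))

      last-cases : (P : SElt n → Set) → P (lst s) → P (lst u) → ∀ {x} → x ∈ S → P (lst x)
      last-cases P p q = each (P ∘ lst) p (subst P (sym lt) p) q (subst P (sym lw) q)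

      occupied-cases : (P : SElt n → Set) → P (lst s) → P (lst u) → ∀ {y} → y ∈ Occupied → P y
      occupied-cases P p q = occupied P p (subst P (sym lt) p) q (subst P (sym lw) q)

      entry : ∀ {p c e} → c ∈ S → e ∈ S → Rival c e → first-abs c ≢ abs (lst s) → first-abs c ≢ abs (lst u) → Entry p (c , e)
      entry {c = c} c∈ e∈ b c≢s c≢u = free-entry c∈ e∈ b (last-cases (λ y → first-abs c ≢ abs y) c≢s c≢u)

      build-pairs : ∀ p X → Opposite p → All (Entry p) X → Unique (map (first-abs ∘ proj₁) X) →
            Covers X s t → Covers X u w → Good s t u w
      build-pairs p X opp es un cst cuw = build p X opp es un cst (apart (l≢ ∘ sym))
        (apart (λ eq → l≢ (trans (sym lw) (sym eq)))) (apart (λ eq → l≢ (trans (sym eq) lt)))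
        (apart (λ eq → l≢ (trans (sym lw) (trans (sym eq) lt)))) cuw

      module _ (a≢b : abs (lst s) ≢ abs (lst u)) where

        -- The two occupied symbols differ even without sign, so nothing forces the choice of `p`.
        opp : ∀ {p} → Opposite p
        opp = opposite-injective λ y∈ z∈ →
          occupied-cases (λ y → ∀ {z} → z ∈ Occupied → abs y ≡ abs z → y ≡ z)
            (λ z∈ → occupied-cases (λ z → abs (lst s) ≡ abs z → lst s ≡ z) (λ _ → refl) (⊥-elim ∘ a≢b) z∈)
            (λ z∈ → occupied-cases (λ z → abs (lst u) ≡ abs z → lst u ≡ z) (⊥-elim ∘ a≢b ∘ sym) (λ _ → refl) z∈)
            y∈ z∈

        two-jokers : first-abs s ≢ abs (lst u) → first-abs u ≢ abs (lst s) → first-abs s ≢ first-abs u → Good s t u w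
        two-jokers s≢b u≢a s≢u = build-pairs (abs (lst s)) ((s , t) ∷ (u , w) ∷ []) opp
          (entry s∈ t∈ st (hd≢lst (S-perm s∈)) s≢b ∷ entry u∈ w∈ uw u≢a (hd≢lst (S-perm u∈)) ∷ []) (unique₂ s≢u)
          (λ _ → inj₁ at₀) (λ _ → inj₁ at₁)

        -- If `w` begins with `lst s`, then `flip w` goes to the opposite cluster, which is empty of
        -- S. Otherwise `flip w` enters the cluster of `s`, where its first symbol provides the
        -- label of `u` once `p` is the first symbol of `u`.
        tight : first-abs s ≢ abs (lst u) → first-abs s ≡ first-abs u →
                first-abs w ≡ abs (lst s) → Good s t u w
        tight s≢b s≡u w≡a with hd w ≟ₑ lst s
        ... | yes h = build-pairs (abs (lst s)) ((s , t) ∷ (w , u) ∷ []) opp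
          (entry s∈ t∈ st (hd≢lst (S-perm s∈)) s≢b ∷ main-entry w∈ u∈ (rival-sym (S-perm u∈) uw) w≡a absent ∷ [])
          (unique₂ (λ eq → hd≢lst (S-perm s∈) (trans eq w≡a))) (λ _ → inj₁ at₀) (λ _ → inj₂ at₁)
          where
          absent : negate (hd w) ∉ Occupied
          absent m = occupied-cases (λ y → negate (hd w) ≢ y) (λ eq → negate-≢ (hd w) (trans eq (sym h)))
            (λ eq → a≢b (trans (sym w≡a) (cong abs eq))) m refl
        ... | no h with same-abs (hd w) (lst s) w≡a
        ...   | inj₁ eq = ⊥-elim (h eq)
        ...   | inj₂ eq = build-natural (first-abs u) ((s , t) ∷ []) w u opp
          (entry s∈ t∈ st (hd≢lst (S-perm s∈)) s≢b ∷ []) unique₁ w∈ u∈ (rival-sym (S-perm u∈) uw) refl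
          (subst (λ a → a ∈ Occupied) (sym (trans (cong negate eq) (negate-involutive (lst s)))) (here refl))
          (λ _ → inj₁ at₀) (apart (l≢ ∘ sym))
          (apart (λ eq → l≢ (trans (sym lw) (sym eq)))) (apart (λ eq → l≢ (trans (sym eq) lt)))
          (apart (λ eq → l≢ (trans (sym lw) (trans (sym eq) lt)))) (λ _ → inj₂ at₁)

      module _ (a≡b : abs (lst s) ≡ abs (lst u)) where

        private
          all-p : ∀ {x} → x ∈ S → abs (lst x) ≡ abs (lst s)
          all-p = last-cases (λ y → abs y ≡ abs (lst s)) refl (sym a≡b)

          E : ∀ {c e} → c ∈ S → e ∈ S → Rival c e → Entry (abs (lst s)) (c , e)
          E c∈ e∈ b = free-entry c∈ e∈ b (λ x∈ eq → hd≢lst (S-perm c∈) (trans eq (trans (all-p x∈) (sym (all-p c∈)))))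

          oppₚ : Opposite (abs (lst s))
          oppₚ y∈ _ = occupied-cases (λ y → abs y ≡ abs (lst s)) refl (sym a≡b) y∈

        -- Every occupied symbol is `p` up to sign, so each endpoint is free; it only remains to
        -- give way at words with different first symbols.
        opposite-clusters : Good s t u w
        opposite-clusters with first-abs s Finₚ.≟ first-abs u
        ... | no s≠u = build-pairs (abs (lst s)) ((s , t) ∷ (u , w) ∷ []) oppₚ (E s∈ t∈ st ∷ E u∈ w∈ uw ∷ []) (unique₂ s≠u)
              (λ _ → inj₁ at₀) (λ _ → inj₁ at₁)
        ... | yes s=u = build-pairs (abs (lst s)) ((t , s) ∷ (u , w) ∷ []) oppₚ
              (E t∈ s∈ (rival-sym (S-perm s∈) st) ∷ E u∈ w∈ uw ∷ [])
              (unique₂ (λ t=u → proj₂ (proj₂ st) (trans s=u (sym t=u))))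
              (λ _ → inj₂ at₀) (λ _ → inj₁ at₁)

    flip-st : ∀ {s t u w} → Perms s t u w → Split s t u w → Split t s u w
    flip-st (ps , _) (st , uw , l≢) = rival-sym ps st , uw , λ eq → l≢ (trans eq (sym (proj₁ (proj₂ st))))

    flip-uw : ∀ {s t u w} → Perms s t u w → Split s t u w → Split s t w u
    flip-uw (_ , _ , pu , _) (st , uw , l≢) = st , rival-sym pu uw , λ eq → l≢ (trans (proj₁ (proj₂ uw)) eq)

    good : ∀ s t u w → Perms s t u w → Split s t u w → Good s t u w
    good s t u w P@(ps , pt , pu , pw) T@((_ , l , s≠t) , (_ , l′ , u≠w) , _) with abs (lst s) Finₚ.≟ abs (lst u)
    ... | yes a≡b = opposite-clusters s t u w P T a≡b
    ... | no a≢b = stepˢ (first-abs s Finₚ.≟ abs (lst u))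
      where
      -- Equal first symbols of `s` and `u` are separated by passing to `t` or to `w`, unless each
      -- of these begins with the last symbol of the other pair.
      step₃ : ∀ s t u w → Perms s t u w → Split s t u w → abs (lst s) ≢ abs (lst u) →
              first-abs s ≢ abs (lst u) → first-abs u ≢ abs (lst s) → Good s t u w
      step₃ s t u w P@(ps , pt , pu , pw) T@((_ , l , s≠t) , (_ , l′ , u≠w) , _) a≢b s≢b u≢a
        with first-abs s Finₚ.≟ first-abs u | first-abs t Finₚ.≟ abs (lst u) | first-abs w Finₚ.≟ abs (lst s)
      ... | no s≢u  | _        | _       = two-jokers s t u w P T a≢b s≢b u≢a s≢u
      ... | yes s≡u | no t≢b   | _       = swap-st (two-jokers t s u w (pt , ps , pu , pw) (flip-st P T)
            (λ eq → a≢b (trans (cong abs l) eq)) t≢b (λ eq → u≢a (trans eq (cong abs (sym l))))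
            (λ eq → s≠t (trans s≡u (sym eq))))
      ... | yes s≡u | yes _    | no w≢a  = swap-uw (two-jokers s t w u (ps , pt , pw , pu) (flip-uw P T)
            (λ eq → a≢b (trans eq (cong abs (sym l′)))) (λ eq → s≢b (trans eq (cong abs (sym l′)))) w≢a
            (λ eq → u≠w (trans (sym s≡u) eq)))
      ... | yes s≡u | yes _    | yes w≡a = tight s t u w P T a≢b s≢b s≡u w≡a
      stepᵘ : ∀ s t → Perms s t u w → Split s t u w → abs (lst s) ≢ abs (lst u) → first-abs s ≢ abs (lst u) → Good s t u w
      stepᵘ s t P@(ps , pt , _) T a≢b s≢b with first-abs u Finₚ.≟ abs (lst s)
      ... | no u≢a  = step₃ s t u w P T a≢b s≢b u≢a
      ... | yes u≡a = swap-uw (step₃ s t w u (ps , pt , pw , pu) (flip-uw P T)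
            (λ eq → a≢b (trans eq (cong abs (sym l′)))) (λ eq → s≢b (trans eq (cong abs (sym l′))))
            (λ w≡a → u≠w (trans u≡a (sym w≡a))))
      stepˢ : Dec (first-abs s ≡ abs (lst u)) → Good s t u w
      stepˢ (no s≢b)  = stepᵘ s t P T a≢b s≢b
      stepˢ (yes s≡b) = swap-st (stepᵘ t s (pt , ps , pu , pw) (flip-st P T)
        (λ eq → a≢b (trans (cong abs l) eq)) (λ t≡b → s≠t (trans s≡b (sym t≡b))))

-- One rival pair, with the other two vertices outside its cluster

module OnePair (m : ℕ) where
  open Pancake m
  open Jokers m
  open Cases m

  Split : V → V → V → V → Set
  Split s t u w = Rival s t × ¬ Rival u w × lst u ≢ lst s × lst w ≢ lst s

  flip-st : ∀ {s t u w} → Perms s t u w → Split s t u w → Split t s u w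
  flip-st (ps , _) (st@(_ , l , _) , uw , lu , lw) =
    rival-sym ps st , uw , (λ eq → lu (trans eq (sym l))) , λ eq → lw (trans eq (sym l))

  flip-uw : ∀ {s t u w} → Perms s t u w → Split s t u w → Split s t w u
  flip-uw (_ , _ , _ , pw) (st , uw , lu , lw) = st , uw ∘ rival-sym pw , lw , lu

  module _ (s t u w : V) (perms : Perms s t u w) (split : Split s t u w) where
    open Four s t u w perms

    private
      st = proj₁ split
      ¬uw = proj₁ (proj₂ split)
      lu = proj₁ (proj₂ (proj₂ split))
      lw = proj₂ (proj₂ (proj₂ split))
      lt : lst t ≡ lst s
      lt = sym (proj₁ (proj₂ st))

      last-cases : (P : SElt n → Set) → P (lst s) → P (lst u) → P (lst w) → ∀ {x} → x ∈ S → P (lst x)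
      last-cases P p q r = each (P ∘ lst) p (subst P (sym lt) p) q r

      occupied-cases : (P : SElt n → Set) → P (lst s) → P (lst u) → P (lst w) → ∀ {y} → y ∈ Occupied → P y
      occupied-cases P p q r = occupied P p (subst P (sym lt) p) q r

      su : ∀ {X} → Covers X s u
      su = apart (lu ∘ sym)
      sw : ∀ {X} → Covers X s w
      sw = apart (lw ∘ sym)
      tu : ∀ {X} → Covers X t u
      tu = apart λ eq → lu (trans (sym eq) lt)
      tw : ∀ {X} → Covers X t w
      tw = apart λ eq → lw (trans (sym eq) lt)

    one-joker : ∀ p → Opposite p → first-abs s ≢ abs (lst u) → first-abs s ≢ abs (lst w) → Good s t u w
    one-joker p opp s≢u s≢w = build p ((s , t) ∷ []) opp
      (free-entry s∈ t∈ st (last-cases (λ y → first-abs s ≢ abs y) (hd≢lst (S-perm s∈)) s≢u s≢w) ∷ [])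
      ([] ∷ []) (λ _ → inj₁ at₀) su sw tu tw (none ¬uw)

    opposite-u : abs (lst u) ≡ abs (lst s) → Opposite (abs (lst s))
    opposite-u eq = opposite-except (lst w)
      (occupied-cases (λ y → abs y ≡ abs (lst s) ⊎ y ≡ lst w) (inj₁ refl) (inj₁ eq) (inj₂ refl))

    opposite-uw : abs (lst u) ≡ abs (lst w) → Opposite (abs (lst u))
    opposite-uw eq = opposite-except (lst s)
      (occupied-cases (λ y → abs y ≡ abs (lst u) ⊎ y ≡ lst s) (inj₂ refl) (inj₁ refl) (inj₁ (sym eq)))

    module _ (u≢s : abs (lst u) ≢ abs (lst s)) (w≢s : abs (lst w) ≢ abs (lst s)) (u≢w : abs (lst u) ≢ abs (lst w)) where

      opp : ∀ {p} → Opposite p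
      opp = opposite-injective λ y∈ z∈ →
        occupied-cases (λ y → ∀ {z} → z ∈ Occupied → abs y ≡ abs z → y ≡ z)
          (occupied-cases (λ z → abs (lst s) ≡ abs z → lst s ≡ z) (λ _ → refl) (⊥-elim ∘ u≢s ∘ sym) (⊥-elim ∘ w≢s ∘ sym))
          (occupied-cases (λ z → abs (lst u) ≡ abs z → lst u ≡ z) (⊥-elim ∘ u≢s) (λ _ → refl) (⊥-elim ∘ u≢w))
          (occupied-cases (λ z → abs (lst w) ≡ abs z → lst w ≡ z) (⊥-elim ∘ w≢s) (⊥-elim ∘ u≢w ∘ sym) (λ _ → refl))
          y∈ z∈

      -- If `s` begins with `lst u`, its reversal reaches the unoccupied opposite cluster, and `p`
      -- as first symbol of `s` tolerates that `u` occupies the other one. If the sign differs,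
      -- `flip s` enters the cluster of `u`; with `p` the first symbol of `t`, both `flip s` and `t`
      -- get the last symbol of `t` as label.
      tight : first-abs s ≡ abs (lst u) → first-abs t ≡ abs (lst w) → Good s t u w
      tight s≡u t≡w with hd s ≟ₑ lst u
      ... | yes h = build (first-abs s) ((s , t) ∷ []) opp (main-entry s∈ t∈ st refl absent ∷ [])
        ([] ∷ []) (λ _ → inj₁ at₀) su sw tu tw (none ¬uw)
        where
        absent : negate (hd s) ∉ Occupied
        absent m = occupied-cases (λ y → negate (hd s) ≢ y) (λ eq → u≢s (trans (sym s≡u) (cong abs eq)))
          (λ eq → negate-≢ (hd s) (trans eq (sym h))) (λ eq → u≢w (trans (sym s≡u) (cong abs eq))) m refl
      ... | no h with same-abs (hd s) (lst u) s≡u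
      ...   | inj₁ eq = ⊥-elim (h eq)
      ...   | inj₂ eq = build-natural (first-abs t) [] s t opp [] [] s∈ t∈ st refl
        (subst (λ a → a ∈ Occupied) (sym (trans (cong negate eq) (negate-involutive (lst u)))) at₂)
        (λ _ → inj₁ at₀) su sw tu tw (none ¬uw)

  -- Of two distinct numbers at most one equals c.
  avoiding : ∀ s t u w → Perms s t u w → Split s t u w → (c : Fin n) →
             (∀ s′ t′ → Perms s′ t′ u w → Split s′ t′ u w → lst s′ ≡ lst s → first-abs s′ ≢ c → Good s′ t′ u w) →
             Good s t u w
  avoiding s t u w P@(ps , pt , pu , pw) T@((_ , l , s≢t) , _) c f with first-abs s Finₚ.≟ c
  ... | no s≢c  = f s t P T refl s≢c
  ... | yes s≡c = swap-st (f t s (pt , ps , pu , pw) (flip-st P T) (sym l) (λ t≡c → s≢t (trans s≡c (sym t≡c))))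

  -- With `p` the common symbol of `s` and `u`, only the last symbol of `w` can bar an endpoint, and
  -- it bars at most one.
  opposite-pair : ∀ s t u w → Perms s t u w → Split s t u w → abs (lst u) ≡ abs (lst s) → Good s t u w
  opposite-pair s t u w P T eq = avoiding s t u w P T (abs (lst w)) λ s′ t′ P′ T′ l s≢w →
    let eq′ = trans eq (cong abs (sym l)) in
    one-joker s′ t′ u w P′ T′ (abs (lst s′)) (opposite-u s′ t′ u w P′ T′ eq′) (λ h → hd≢lst (proj₁ P′) (trans h eq′)) s≢w

  good : ∀ s t u w → Perms s t u w → Split s t u w → Good s t u w
  good s t u w P@(ps , pt , pu , pw) T@(st@(_ , l , s≢t) , _)
    with abs (lst u) Finₚ.≟ abs (lst s) | abs (lst w) Finₚ.≟ abs (lst s) | abs (lst u) Finₚ.≟ abs (lst w)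
  ... | yes u≡s | _       | _       = opposite-pair s t u w P T u≡s
  ... | no u≢s  | yes w≡s | _       = swap-uw (opposite-pair s t w u (ps , pt , pw , pu) (flip-uw P T) w≡s)
  ... | no u≢s  | no w≢s  | yes u≡w = avoiding s t u w P T (abs (lst u)) λ s′ t′ P′ T′ _ s≢u →
    one-joker s′ t′ u w P′ T′ (abs (lst u)) (opposite-uw s′ t′ u w P′ T′ u≡w) s≢u (λ eq → s≢u (trans eq (sym u≡w)))
  ... | no u≢s  | no w≢s  | no u≢w  = go (hits s) (hits t)
    where
    Hit : V → Set
    Hit x = first-abs x ≡ abs (lst u) ⊎ first-abs x ≡ abs (lst w)
    hits : ∀ x → Dec (Hit x)
    hits x = (first-abs x Finₚ.≟ abs (lst u)) ⊎-dec (first-abs x Finₚ.≟ abs (lst w))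
    lt : ∀ {x} → x ≢ abs (lst s) → x ≢ abs (lst t)
    lt x≢ eq = x≢ (trans eq (cong abs (sym l)))
    go : Dec (Hit s) → Dec (Hit t) → Good s t u w
    go (no ¬s) _ = one-joker s t u w P T (abs (lst s)) (opp s t u w P T u≢s w≢s u≢w) (¬s ∘ inj₁) (¬s ∘ inj₂)
    go (yes _) (no ¬t) = swap-st (one-joker t s u w (pt , ps , pu , pw) (flip-st P T) (abs (lst t))
      (opp t s u w (pt , ps , pu , pw) (flip-st P T) (lt u≢s) (lt w≢s) u≢w) (¬t ∘ inj₁) (¬t ∘ inj₂))
    go (yes (inj₁ s≡u)) (yes (inj₁ t≡u)) = ⊥-elim (s≢t (trans s≡u (sym t≡u)))
    go (yes (inj₂ s≡w)) (yes (inj₂ t≡w)) = ⊥-elim (s≢t (trans s≡w (sym t≡w)))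
    go (yes (inj₁ s≡u)) (yes (inj₂ t≡w)) = tight s t u w P T u≢s w≢s u≢w s≡u t≡w
    go (yes (inj₂ s≡w)) (yes (inj₁ t≡u)) = swap-uw (tight s t w u (ps , pt , pw , pu) (flip-uw P T) w≢s u≢s (u≢w ∘ sym) s≡w t≡u)

-- The one placement of S that leaves no sign free for the label q: one vertex in each of the
-- clusters ± p, ± q. The cluster (k , true) then serves as hub for q, and the words of the four
-- clusters starting with ± k are shared between the labels k and q by the sign with which
-- the other of p, q occurs in them.
module Opposites (m : ℕ) where
  open Pancake m
  open Assembly m
  open Cases m

  module _ (s t u w : V) (perms : Perms s t u w) (lst-t : lst t ≡ negate (lst s)) (lst-w : lst w ≡ negate (lst u))
           (k : Fin n) (p≢q : abs (lst s) ≢ abs (lst u)) (k≢p : k ≢ abs (lst s)) (k≢q : k ≢ abs (lst u)) where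
    open Four s t u w perms using (S; each; S-perm; s∈; t∈; u∈; w∈)

    private
      open Dec∈ (_≟ₑ_ {n}) using (_∈?_)

      p q : Fin n
      p = abs (lst s)
      q = abs (lst u)

      PQ : Fin n → Set
      PQ j = j ≡ p ⊎ j ≡ q

      PQ? : ∀ j → Dec (PQ j)
      PQ? j = (j Finₚ.≟ p) ⊎-dec (j Finₚ.≟ q)

      ¬PQ-k : ¬ PQ k
      ¬PQ-k = [ k≢p , k≢q ]′

      S-PQ : ∀ {x} → x ∈ S → PQ (abs (lst x))
      S-PQ = each (PQ ∘ abs ∘ lst) (inj₁ refl) (inj₁ (cong abs lst-t)) (inj₂ refl) (inj₂ (cong abs lst-w))

      other : Fin n → Fin n
      other j with j Finₚ.≟ p
      ... | yes _ = q
      ... | no _  = p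

      other-PQ : ∀ j → PQ (other j)
      other-PQ j with j Finₚ.≟ p
      ... | yes _ = inj₂ refl
      ... | no _  = inj₁ refl

      other-≢ : ∀ j → PQ j → other j ≢ j
      other-≢ j pq with j Finₚ.≟ p
      other-≢ j pq        | yes refl = p≢q ∘ sym
      other-≢ j (inj₁ eq) | no j≢p   = ⊥-elim (j≢p eq)
      other-≢ j (inj₂ eq) | no j≢p   = j≢p ∘ sym

      k≢other : ∀ j → k ≢ other j
      k≢other j eq = ¬PQ-k (subst PQ (sym eq) (other-PQ j))

      lst-injective : ∀ {x y} → x ∈ S → y ∈ S → lst x ≡ lst y → x ≡ y
      lst-injective x∈ y∈ = each (λ x → ∀ {y} → y ∈ S → lst x ≡ lst y → x ≡ y)
        (each (λ y → lst s ≡ lst y → s ≡ y) (λ _ → refl) (λ eq → ⊥-elim (negate-≢ (lst s) (sym (trans eq lst-t))))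
              (λ eq → ⊥-elim (p≢q (cong abs eq))) (λ eq → ⊥-elim (p≢q (cong abs (trans eq lst-w)))))
        (each (λ y → lst t ≡ lst y → t ≡ y) (λ eq → ⊥-elim (negate-≢ (lst s) (trans (sym lst-t) eq))) (λ _ → refl)
              (λ eq → ⊥-elim (p≢q (cong abs (trans (sym lst-t) eq)))) (λ eq → ⊥-elim (p≢q (cong abs (trans (sym lst-t) (trans eq lst-w))))))
        (each (λ y → lst u ≡ lst y → u ≡ y) (λ eq → ⊥-elim (p≢q (cong abs (sym eq)))) (λ eq → ⊥-elim (p≢q (cong abs (sym (trans eq lst-t)))))
              (λ _ → refl) (λ eq → ⊥-elim (negate-≢ (lst u) (sym (trans eq lst-w)))))
        (each (λ y → lst w ≡ lst y → w ≡ y) (λ eq → ⊥-elim (p≢q (cong abs (trans (sym eq) lst-w))))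
              (λ eq → ⊥-elim (p≢q (cong abs (trans (sym lst-t) (trans (sym eq) lst-w)))))
              (λ eq → ⊥-elim (negate-≢ (lst u) (trans (sym lst-w) eq))) (λ _ → refl))
        x∈ y∈

      -- The sign that decides between `k` and `q` in a cluster is read off the neighbour of its
      -- vertex of S that begins with `k`; so this neighbour falls to the tree `k`.
      Sample : V → Bool → Set
      Sample x b = ∃[ v ] (x ≈ v × abs (hd v) ≡ k × (other (abs (lst x)) , b) ∈ v)

      sample : ∀ {x} → x ∈ S → ∃ (Sample x)
      sample {x} x∈ with bring-hd (S-perm x∈) (λ eq → ¬PQ-k (subst PQ (sym eq) (S-PQ x∈)))
      ... | v , e@(_ , pv , _) , h with ∈ₚ.∈-map⁻ proj₁ (symbol∈ pv (other (abs (lst x))))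
      ... | (_ , b) , a∈ , refl = b , v , e , h , a∈

    module _ (σ : SElt n → Bool) (σ-sample : ∀ {x} → x ∈ S → Sample x (σ (lst x))) where

      private
        mark : SElt n → SElt n
        mark l = other (abs l) , σ l

        choose : ∀ {A B C D E : Set} → Dec A → Dec B → Dec C → Dec D → Dec E → Fin n → Fin n → Fin n
        choose (no _)  (yes _) _       _       _       h l = q
        choose (no _)  (no _)  _       _       _       h l = l
        choose (yes _) _       (yes _) _       _       h l = q
        choose (yes _) _       (no _)  (yes _) (yes _) h l = k
        choose (yes _) _       (no _)  (yes _) (no _)  h l = q
        choose (yes _) _       (no _)  (no _)  _       h l = h

        ℓ : V → Fin n
        ℓ x = choose (PQ? (abs (lst x))) (lst x ≟ₑ (k , true)) (PQ? (abs (hd x))) (abs (hd x) Finₚ.≟ k)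
                     (mark (lst x) ∈? x) (abs (hd x)) (abs (lst x))

        ℓ-hub-q : ∀ x → lst x ≡ (k , true) → ℓ x ≡ q
        ℓ-hub-q x eq with PQ? (abs (lst x)) | lst x ≟ₑ (k , true)
        ... | yes pq | _     = ⊥-elim (¬PQ-k (subst PQ (cong abs eq) pq))
        ... | no _   | yes _ = refl
        ... | no _   | no ≢  = ⊥-elim (≢ eq)

        ℓ-hub : ∀ x → ¬ PQ (abs (lst x)) → lst x ≢ (k , true) → ℓ x ≡ abs (lst x)
        ℓ-hub x ¬pq l≢ with PQ? (abs (lst x)) | lst x ≟ₑ (k , true)
        ... | yes pq | _      = ⊥-elim (¬pq pq)
        ... | no _   | yes eq = ⊥-elim (l≢ eq)
        ... | no _   | no _   = refl

        ℓ-PQ : ∀ x → PQ (abs (lst x)) → PQ (abs (hd x)) → ℓ x ≡ q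
        ℓ-PQ x pq h with PQ? (abs (lst x)) | PQ? (abs (hd x))
        ... | no ¬pq | _     = ⊥-elim (¬pq pq)
        ... | yes _  | no ¬h = ⊥-elim (¬h h)
        ... | yes _  | yes _ = refl

        ℓ-first : ∀ x → PQ (abs (lst x)) → ¬ PQ (abs (hd x)) → abs (hd x) ≢ k → ℓ x ≡ abs (hd x)
        ℓ-first x pq ¬h h≢k with PQ? (abs (lst x)) | PQ? (abs (hd x)) | abs (hd x) Finₚ.≟ k
        ... | no ¬pq | _     | _      = ⊥-elim (¬pq pq)
        ... | yes _  | yes h | _      = ⊥-elim (¬h h)
        ... | yes _  | no _  | yes eq = ⊥-elim (h≢k eq)
        ... | yes _  | no _  | no _   = refl

        ℓ-marked : ∀ x → PQ (abs (lst x)) → abs (hd x) ≡ k → mark (lst x) ∈ x → ℓ x ≡ k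
        ℓ-marked x pq eq mk with PQ? (abs (lst x)) | PQ? (abs (hd x)) | abs (hd x) Finₚ.≟ k | mark (lst x) ∈? x
        ... | no ¬pq | _     | _     | _     = ⊥-elim (¬pq pq)
        ... | yes _  | yes h | _     | _     = ⊥-elim (¬PQ-k (subst PQ eq h))
        ... | yes _  | no _  | no ≢  | _     = ⊥-elim (≢ eq)
        ... | yes _  | no _  | yes _ | no ∉  = ⊥-elim (∉ mk)
        ... | yes _  | no _  | yes _ | yes _ = refl

        ℓ-unmarked : ∀ x → PQ (abs (lst x)) → abs (hd x) ≡ k → mark (lst x) ∉ x → ℓ x ≡ q
        ℓ-unmarked x pq eq mk with PQ? (abs (lst x)) | PQ? (abs (hd x)) | abs (hd x) Finₚ.≟ k | mark (lst x) ∈? x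
        ... | no ¬pq | _     | _     | _      = ⊥-elim (¬pq pq)
        ... | yes _  | yes h | _     | _      = ⊥-elim (¬PQ-k (subst PQ eq h))
        ... | yes _  | no _  | no ≢  | _      = ⊥-elim (≢ eq)
        ... | yes _  | no _  | yes _ | yes m∈ = ⊥-elim (mk m∈)
        ... | yes _  | no _  | yes _ | no _   = refl

        hub : Fin n → SElt n
        hub j with j Finₚ.≟ q
        ... | yes _ = k , true
        ... | no _  = j , false

        hub-q : hub q ≡ (k , true)
        hub-q with q Finₚ.≟ q
        ... | yes _ = refl
        ... | no ≢  = ⊥-elim (≢ refl)

        hub-≢q : ∀ j → j ≢ q → hub j ≡ (j , false)
        hub-≢q j j≢q with j Finₚ.≟ q
        ... | yes eq = ⊥-elim (j≢q eq)
        ... | no _   = refl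

        hub-label : ∀ j → j ≢ p → ∀ x → lst x ≡ hub j → ℓ x ≡ j
        hub-label j j≢p x l with j Finₚ.≟ q
        ... | yes refl = ℓ-hub-q x l
        ... | no j≢q   = trans (ℓ-hub x (λ pq → [ j≢p , j≢q ]′ (subst PQ (cong abs l) pq)) (λ eq → case trans (sym l) eq of λ ()))
                               (cong abs l)

        open Hubs p ℓ hub hub-label

        -- S has one vertex in each of its clusters, so no arc joins two different vertices of S.
        Arc : V → V → Set
        Arc x y = lst x ≡ lst y

        open Link S ℓ Arc

        via : ∀ {s v j} → s ∈ S → s ≈ v → ℓ v ≡ j → Star (Own j) v (root j) → Star (Link j) s (root j)
        via s∈ (ps , pv , a , l) ℓv st = (ps , pv , a , ℓv , inj₂ (s∈ , l)) ◅
          gmap id (λ { (px , py , a , ℓx , ℓy) → px , py , a , ℓy , inj₁ ℓx }) st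

        -- Correcting the sign of the first symbol must not disturb the mark, which is a different
        -- symbol.
        tail-∈ : ∀ {x y a} → Perm x → a ∈ x → abs a ≢ abs (hd x) → drop 1 y ≡ drop 1 x → a ∈ y
        tail-∈ {_ ∷ x} px (here refl) ≢ _ = ⊥-elim (≢ refl)
        tail-∈ {_ ∷ x} {_ ∷ y} px (there a∈) _ refl = there a∈
        tail-∈ {_ ∷ x} {[]} px (there a∈) _ refl with () ← a∈

        PQ-lst : ∀ {a b : SElt n} → a ≡ b → PQ (abs b) → PQ (abs a)
        PQ-lst refl pq = pq

        path-k : ∀ {s} → s ∈ S → Star (Link k) s (root k)
        path-k {s} s∈ with σ-sample s∈
        ... | v , e@(_ , pv , _ , l) , h , m∈ with PQ-lst (sym l) (S-PQ s∈) | subst (λ l → mark l ∈ v) l m∈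
        ... | pq | mk with set-sign (negate (hub k)) pv (trans (cong abs (cong negate (hub-≢q k k≢q))) (sym h))
        ...   | inj₁ hv = via s∈ e ℓv (flip-hub k≢p pv ℓv hv)
          where
          ℓv = ℓ-marked v pq h mk
        ...   | inj₂ (y , (_ , py , a , l′) , hy , d) = via s∈ e ℓv ((pv , py , a , ℓv , ℓy) ◅ flip-hub k≢p py ℓy hy)
          where
          ℓv = ℓ-marked v pq h mk
          my : mark (lst y) ∈ y
          my = subst (λ l → mark l ∈ y) l′ (tail-∈ pv mk (λ eq → k≢other (abs (lst v)) (trans (sym h) (sym eq))) d)
          ℓy = ℓ-marked y (PQ-lst (sym l′) pq) (trans (cong abs hy) (cong abs (cong negate (hub-≢q k k≢q)))) my

        path-j : ∀ {s} j → j ≢ p → j ≢ q → j ≢ k → s ∈ S → Star (Link j) s (root j)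
        path-j {s} j j≢p j≢q j≢k s∈ with bring-hd (S-perm s∈) (λ eq → [ j≢p , j≢q ]′ (subst PQ (sym eq) (S-PQ s∈)))
        ... | v , e@(_ , pv , _ , l) , h with set-sign (negate (hub j)) pv (trans (cong abs (cong negate (hub-≢q j j≢q))) (sym h))
        ...   | inj₁ hv = via s∈ e ℓv (flip-hub j≢p pv ℓv hv)
          where
          ℓv = trans (ℓ-first v (PQ-lst (sym l) (S-PQ s∈)) (λ pq → [ j≢p , j≢q ]′ (subst PQ h pq)) (λ eq → j≢k (trans (sym h) eq))) h
        ...   | inj₂ (y , (_ , py , a , l′) , hy , _) = via s∈ e ℓv ((pv , py , a , ℓv , ℓy) ◅ flip-hub j≢p py ℓy hy)
          where
          pq = PQ-lst (sym l) (S-PQ s∈)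
          h′ : abs (hd y) ≡ j
          h′ = trans (cong abs hy) (cong abs (cong negate (hub-≢q j j≢q)))
          ℓv = trans (ℓ-first v pq (λ pq → [ j≢p , j≢q ]′ (subst PQ h pq)) (λ eq → j≢k (trans (sym h) eq))) h
          ℓy = trans (ℓ-first y (PQ-lst (sym l′) pq) (λ pq → [ j≢p , j≢q ]′ (subst PQ h′ pq)) (λ eq → j≢k (trans (sym h′) eq))) h′

        unmarked : ∀ {a x} → Perm x → negate a ∈ x → a ∉ x
        unmarked {a} px na∈ a∈ = negate-≢ a (abs-unique px na∈ a∈ refl)

        walk-unmarked : ∀ {x} → Perm x → PQ (abs (lst x)) → abs (hd x) ≡ k → negate (mark (lst x)) ∈ x →
                        Star (Own q) x (root q)
        walk-unmarked {x} px pq h nm with set-sign (negate (hub q)) px (trans (cong abs (cong negate hub-q)) (sym h))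
        ... | inj₁ hx = flip-hub (p≢q ∘ sym) px (ℓ-unmarked x pq h (unmarked px nm)) hx
        ... | inj₂ (y , (_ , py , a , l) , hy , d) =
          (px , py , a , ℓ-unmarked x pq h (unmarked px nm) , ℓy) ◅ flip-hub (p≢q ∘ sym) py ℓy hy
          where
          nmy : negate (mark (lst y)) ∈ y
          nmy = subst (λ l → negate (mark l) ∈ y) l (tail-∈ px nm (λ eq → k≢other (abs (lst x)) (trans (sym h) (sym eq))) d)
          ℓy = ℓ-unmarked y (PQ-lst (sym l) pq) (trans (cong abs hy) (cong abs (cong negate hub-q))) (unmarked py nmy)

        -- Bringing `k` forward reverses a block that contains the leading mark and changes its
        -- sign. The new word is unmarked, so it belongs to `q` and may go on to the cluster
        -- `(k , true)`.
        walk-marked : ∀ {x} → Perm x → PQ (abs (lst x)) → hd x ≡ mark (lst x) → Star (Own q) x (root q)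
        walk-marked {x} px pq h with bring px (λ eq → ¬PQ-k (subst PQ (sym eq) pq))
        ... | [] , a , b , z , refl , refl = ⊥-elim (k≢other (abs (lst (a ∷ b ∷ z))) (cong abs h))
        ... | c ∷ v , a , b , z , refl , abs-a with turn-≈ (c ∷ v) a b z px
        ...   | (_ , py , e , l) = (px , py , e , ℓx , ℓy) ◅ walk-unmarked py (PQ-lst (sym l) pq) abs-a nm
          where
          nm : negate (mark (lst (turn (c ∷ v) a (b ∷ z)))) ∈ turn (c ∷ v) a (b ∷ z)
          nm = subst (λ d → negate d ∈ turn (c ∷ v) a (b ∷ z)) (trans h (cong mark l))
                 (there (∈ₚ.∈-++⁺ˡ {xs = rev (c ∷ v)} (∈ₚ.∈-map⁺ negate (Anyₚ.reverse⁺ {xs = c ∷ v} (here refl)))))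
          ℓx = ℓ-PQ (c ∷ v ++ a ∷ b ∷ z) pq (subst PQ (sym (cong abs h)) (other-PQ (abs (lst (c ∷ v ++ a ∷ b ∷ z)))))
          ℓy = ℓ-unmarked (turn (c ∷ v) a (b ∷ z)) (PQ-lst (sym l) pq) abs-a (unmarked py nm)

        path-q : ∀ {s} → s ∈ S → Star (Link q) s (root q)
        path-q {s} s∈ with bring-hd (S-perm s∈) (other-≢ (abs (lst s)) (S-PQ s∈))
        ... | v , e@(_ , pv , _ , l) , h with set-sign (mark (lst v)) pv (trans (cong (other ∘ abs) (sym l)) (sym h))
        ...   | inj₁ hv = via s∈ e ℓv (walk-marked pv pq hv)
          where
          pq = PQ-lst (sym l) (S-PQ s∈)
          ℓv = ℓ-PQ v pq (subst PQ (sym h) (other-PQ (abs (lst s))))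
        ...   | inj₂ (y , (_ , py , a , l′) , hy , _) = via s∈ e ℓv ((pv , py , a , ℓv , ℓy) ◅ walk-marked py pqy (trans hy (cong mark l′)))
          where
          pq = PQ-lst (sym l) (S-PQ s∈)
          pqy = PQ-lst (sym l′) pq
          ℓv = ℓ-PQ v pq (subst PQ (sym h) (other-PQ (abs (lst s))))
          ℓy = ℓ-PQ y pqy (subst PQ (sym (cong abs hy)) (other-PQ (abs (lst v))))

        paths : ∀ {s} j → j ≢ p → s ∈ S → Star (Link j) s (root j)
        paths {s} j j≢p s∈ = go (j Finₚ.≟ q) (j Finₚ.≟ k)
          where
          go : Dec (j ≡ q) → Dec (j ≡ k) → Star (Link j) s (root j)
          go (yes eq) _        = subst (λ j → Star (Link j) s (root j)) (sym eq) (path-q s∈)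
          go (no _) (yes eq)   = subst (λ j → Star (Link j) s (root j)) (sym eq) (path-k s∈)
          go (no j≢q) (no j≢k) = path-j j j≢p j≢q j≢k s∈

      good-σ : Good s t u w
      good-σ = assemble (λ s∈ t∈ _ l _ → cong ℓ (lst-injective s∈ t∈ l)) root root-perm root-label paths

    good : Good s t u w
    good = good-σ σ σ-sample
      where
      σ : SElt n → Bool
      σ y with y ≟ₑ lst s | y ≟ₑ lst t | y ≟ₑ lst u
      ... | yes _ | _     | _     = proj₁ (sample s∈)
      ... | no _  | yes _ | _     = proj₁ (sample t∈)
      ... | no _  | no _  | yes _ = proj₁ (sample u∈)
      ... | no _  | no _  | no _  = proj₁ (sample w∈)
      at : ∀ {x y} → x ∈ S → (y∈ : y ∈ S) → lst x ≡ lst y → Sample x (proj₁ (sample y∈))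
      at x∈ y∈ l = subst (λ z → Sample z (proj₁ (sample y∈))) (sym (lst-injective x∈ y∈ l)) (proj₂ (sample y∈))
      σ-sample : ∀ {x} → x ∈ S → Sample x (σ (lst x))
      σ-sample {x} x∈ with lst x ≟ₑ lst s | lst x ≟ₑ lst t | lst x ≟ₑ lst u
      ... | yes l | _     | _     = at x∈ s∈ l
      ... | no _  | yes l | _     = at x∈ t∈ l
      ... | no _  | no _  | yes l = at x∈ u∈ l
      ... | no s≢ | no t≢ | no u≢ = at x∈ w∈ (each (λ x → lst x ≢ lst s → lst x ≢ lst t → lst x ≢ lst u → lst x ≡ lst w)
        (λ ≢ _ _ → ⊥-elim (≢ refl)) (λ _ ≢ _ → ⊥-elim (≢ refl)) (λ _ _ ≢ → ⊥-elim (≢ refl)) (λ _ _ _ → refl) x∈ s≢ t≢ u≢)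

-- Assembling the lower bound

third : ∀ {k} (a b : Fin (suc (suc (suc k)))) → a ≢ b → ∃[ c ] (c ≢ a × c ≢ b)
third a b a≢b = punchIn a c , Finₚ.punchInᵢ≢i a c , λ eq →
  Finₚ.punchInᵢ≢i (punchOut a≢b) zero (Finₚ.punchIn-injective a _ _ (trans eq (sym (Finₚ.punchIn-punchOut a≢b))))
  where c = punchIn (punchOut a≢b) zero

unique-⊇ : ∀ {A : Set} → DecidableEquality A → {xs ys : List A} → Unique xs → xs ⊆ ys → length ys ≤ length xs → ys ⊆ xs
unique-⊇ _≟_ {xs} {ys} U xs⊆ le {y} y∈ with y ∈? xs
  where open Dec∈ _≟_ using (_∈?_)
... | yes y∈xs = y∈xs
... | no y∉    = ⊥-elim (ℕₚ.1+n≰n (ℕₚ.≤-trans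
      (unique-⊆-length (Allₚ.¬Any⇒All¬ _ y∉ ∷ U) (λ { (here refl) → y∈ ; (there x∈) → xs⊆ x∈ })) le))

module LowerBound (m : ℕ) where
  open Pancake m
  open Cases m

  good-rivals : ∀ s t u w → Perms s t u w → Unique (s ∷ t ∷ u ∷ w ∷ []) → Rival s t → Good s t u w
  good-rivals s t u w P@(ps , pt , pu , pw) U@((s≢t ∷ s≢u ∷ s≢w ∷ []) ∷ (t≢u ∷ t≢w ∷ []) ∷ _) st@(_ , l , _) =
    go (lst u ≟ₑ lst s) (lst w ≟ₑ lst s) (rival? u w)
    where
    go : Dec (lst u ≡ lst s) → Dec (lst w ≡ lst s) → Dec (Rival u w) → Good s t u w
    go (yes lu) (yes lw) _ = OneCluster.good s t u w P U (sym l , lu , lw) st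
    go (yes lu) (no lw)  _ = ThreeAndOne.good s t u w P s≢u t≢u (sym l , lu , lw) st
    go (no lu)  (yes lw) _ = swap-uw (ThreeAndOne.good s t w u (ps , pt , pw , pu) s≢w t≢w (sym l , lw , lu) st)
    go (no lu)  (no lw)  (yes uw) = TwoPairs.good s t u w P (st , uw , lu)
    go (no lu)  (no lw)  (no ¬uw) = OnePair.good m s t u w P (st , ¬uw , lu , lw)

  no-rivals : (∀ {a b} → a ≢ b → ∃[ c ] (c ≢ a × c ≢ b)) →
           ∀ s t u w → Perms s t u w → Unique (s ∷ t ∷ u ∷ w ∷ []) →
           ¬ Rival s t → ¬ Rival s u → ¬ Rival s w → ¬ Rival t u → ¬ Rival t w → ¬ Rival u w → Good s t u w
  no-rivals third s t u w P U st su sw tu tw uw = go (Any.any? (λ y → negate y ∈? Occupied) Occupied)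
    where
    open Four s t u w P
    open Dec∈ (_≟ₑ_ {n}) using (_∈?_)

    plain : ∀ p → Opposite p → Good s t u w
    plain p opp = build p [] opp [] [] (none st) (none su) (none sw) (none tu) (none tw) (none uw)

    ending : ∀ {y} → y ∈ Occupied → ∃[ x ] (x ∈ S × lst x ≡ y)
    ending y∈ = let x , x∈ , eq = ∈ₚ.∈-map⁻ lst y∈ in x , x∈ , sym eq

    -- The four signed symbols are distinct, so words ending in them are four distinct members of S
    -- and exhaust it.
    two-pairs : ∀ {y z} → y ∈ Occupied → negate y ∈ Occupied → z ∈ Occupied → negate z ∈ Occupied →
                abs y ≢ abs z → Good s t u w
    two-pairs y∈ ny∈ z∈ nz∈ y≢z with ending y∈ | ending ny∈ | ending z∈ | ending nz∈
    ... | s′ , s∈′ , refl | t′ , t∈′ , lt | u′ , u∈′ , refl | w′ , w∈′ , lw =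
      let k , k≢p , k≢q = third y≢z in
      family-⊆ sub-S S-sub
        (Opposites.good m s′ t′ u′ w′ (S-perm s∈′ , S-perm t∈′ , S-perm u∈′ , S-perm w∈′) lt lw k y≢z k≢p k≢q)
      where
      sub-S : s′ ∷ t′ ∷ u′ ∷ w′ ∷ [] ⊆ S
      sub-S (here refl)                         = s∈′
      sub-S (there (here refl))                 = t∈′
      sub-S (there (there (here refl)))         = u∈′
      sub-S (there (there (there (here refl)))) = w∈′
      U′ : Unique (s′ ∷ t′ ∷ u′ ∷ w′ ∷ [])
      U′ = unique₄
        (λ { refl → negate-≢ (lst s′) (sym lt) })
        (λ { refl → y≢z refl })
        (λ { refl → y≢z (cong abs lw) })
        (λ { refl → y≢z (sym (cong abs lt)) })
        (λ { refl → y≢z (trans (sym (cong abs lt)) (cong abs lw)) })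
        (λ { refl → negate-≢ (lst u′) (sym lw) })
      S-sub : S ⊆ s′ ∷ t′ ∷ u′ ∷ w′ ∷ []
      S-sub = unique-⊇ _≟ʷ_ U′ sub-S ℕₚ.≤-refl

    go : Dec _ → Good s t u w
    -- Without opposite clusters any `p` serves; a single symbol with both clusters occupied has to
    -- be `p`.
    go (no ¬o) = plain zero (λ y∈ ny∈ → ⊥-elim (¬o (lose y∈ ny∈)))
    go (yes o) with ∈-find o
    ... | y , y∈ , ny∈ with Any.any? (λ z → ¬? (abs y Finₚ.≟ abs z) ×-dec (negate z ∈? Occupied)) Occupied
    ...   | no ¬o = plain (abs y) (λ {z} z∈ nz∈ → case abs y Finₚ.≟ abs z of λ where
              (yes eq) → sym eq
              (no ≢)   → ⊥-elim (¬o (lose z∈ (≢ , nz∈))))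
    ...   | yes o′ with ∈-find o′
    ...     | z , z∈ , y≢z , nz∈ = two-pairs y∈ ny∈ z∈ nz∈ y≢z

  good : (∀ {a b} → a ≢ b → ∃[ c ] (c ≢ a × c ≢ b)) →
         ∀ s t u w → Perms s t u w → Unique (s ∷ t ∷ u ∷ w ∷ []) → Good s t u w
  good third s t u w P@(ps , pt , pu , pw) U@((s≢t ∷ s≢u ∷ s≢w ∷ []) ∷ (t≢u ∷ t≢w ∷ []) ∷ (u≢w ∷ []) ∷ _) =
    go (rival? s t) (rival? s u) (rival? s w) (rival? t u) (rival? t w) (rival? u w)
    where
    go : Dec (Rival s t) → Dec (Rival s u) → Dec (Rival s w) → Dec (Rival t u) → Dec (Rival t w) → Dec (Rival u w) → Good s t u w
    go (yes b) _ _ _ _ _ = good-rivals s t u w P U b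
    go _ (yes b) _ _ _ _ = swap-tu (good-rivals s u t w (ps , pu , pt , pw) (unique₄ s≢u s≢t s≢w (t≢u ∘ sym) u≢w t≢w) b)
    go _ _ (yes b) _ _ _ = swap-uw (swap-tu (good-rivals s w t u (ps , pw , pt , pu)
      (unique₄ s≢w s≢t s≢u (t≢w ∘ sym) (u≢w ∘ sym) t≢u) b))
    go _ _ _ (yes b) _ _ = swap-st (swap-tu (good-rivals t u s w (pt , pu , ps , pw)
      (unique₄ t≢u (s≢t ∘ sym) t≢w (s≢u ∘ sym) u≢w s≢w) b))
    go _ _ _ _ (yes b) _ = swap-st (swap-uw (swap-tu (good-rivals t w s u (pt , pw , ps , pu)
      (unique₄ t≢w (s≢t ∘ sym) t≢u (s≢w ∘ sym) (u≢w ∘ sym) s≢u) b)))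
    go _ _ _ _ _ (yes b) = swap-tu (swap-st (swap-uw (swap-tu (good-rivals u w s t (pu , pw , ps , pt)
      (unique₄ u≢w (s≢u ∘ sym) (t≢u ∘ sym) (s≢w ∘ sym) (t≢w ∘ sym) s≢t) b))))
    go (no st) (no su) (no sw) (no tu) (no tw) (no uw) = no-rivals third s t u w P U st su sw tu tw uw

-- Two symbols leave no third one for the construction with `k`, but n - 1 = 1: under a constant
-- label the tree only needs connectedness.
one-tree : ∀ {S : List (SWord 2)} {x} → x ∈ S → (∀ {s} → s ∈ S → IsSignedPerm 2 s) → Family (BP 2) S 1
one-tree {S} {x} x∈ S-perm = assemble (λ _ _ _ _ _ → refl) {p = zero} (λ _ → x) (λ _ → S-perm x∈) (λ j j≢ → only j j≢) paths
  where
  open Pancake 0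
  open Assembly 0
  ℓ : V → Fin 2
  ℓ _ = suc zero
  open Link S ℓ (λ _ _ → ⊤)
  only : ∀ (j : Fin 2) → j ≢ zero → suc zero ≡ j
  only zero       j≢ = ⊥-elim (j≢ refl)
  only (suc zero) _  = refl
  paths : ∀ {s} j → j ≢ zero → s ∈ S → Star (Link j) s x
  paths j j≢ s∈ = gmap id (λ { (p , q , e) → p , q , e , only j j≢ , inj₁ (only j j≢) }) (connected (S-perm s∈) (S-perm x∈))

lower-bound : ∀ m s t u w → Cases.Perms m s t u w → Unique (s ∷ t ∷ u ∷ w ∷ []) → Cases.Good m s t u w
lower-bound zero    s t u w P _ = one-tree {x = s} (here refl) (Cases.Four.S-perm 0 s t u w P)
lower-bound (suc m) s t u w P U = LowerBound.good (suc m) (λ {a} {b} a≢b → third a b a≢b) s t u w P U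

-- The value of the minimum

module Value (m : ℕ) where
  open Pancake m
  open Assembly m using (unbarred; some-perm)
  open Cases m using (Perms; adj?)
  open Families (BP n) _≟ʷ_ adj-sym

  nbr : V → Fin n → V
  nbr x k = prefixRev x (suc (toℕ k))

  nbr-complete : ∀ {x y} → Perm x → x ~ y → ∃[ k ] y ≡ nbr x k
  nbr-complete {x} _ (suc i , _ , i< , eq) =
    fromℕ< i< , trans eq (cong (λ j → prefixRev x (suc j)) (sym (Finₚ.toℕ-fromℕ< i<)))

  open Degree (BP n) _≟ʷ_ adj-sym nbr nbr-complete

  all-words : List V
  all-words = listsUpTo (cartesianProduct (allFin n) (false ∷ true ∷ [])) n

  all-words-complete : ∀ {x} → Perm x → x ∈ all-words
  all-words-complete {x} (l , _) = ∈-listsUpTo x (λ { {a , b} _ → ∈ₚ.∈-cartesianProduct⁺ (∈ₚ.∈-allFin a) (bools b) }) (ℕₚ.≤-reflexive l)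
    where
    bools : ∀ b → b ∈ false ∷ true ∷ []
    bools false = here refl
    bools true  = there (here refl)

  perm? : ∀ x → Dec (Perm x)
  perm? x = (length x ℕₚ.≟ n) ×-dec unique? Finₚ._≟_ (map proj₁ x)

  kappa-exists : ∀ S → IsKSubset (BP n) 4 S → Σ ℕ λ r → KappaS (BP n) S r × suc m ≤ r
  kappa-exists (s ∷ t ∷ u ∷ w ∷ []) (U@((s≢t ∷ _) ∷ _) , _ , inV) with family? (inV s (here refl)) n
    where open Decide perm? adj? all-words all-words-complete s (t ∷ u ∷ w ∷ [])
  ... | yes F = n , (F , λ r F → degree-bound F (here refl) (there (here refl)) s≢t) , ℕₚ.n≤1+n (suc m)
  ... | no ¬F = suc m , (lower-bound m s t u w perms U , bound) , ℕₚ.≤-refl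
    where
    perms : Perms s t u w
    perms = inV s (here refl) , inV t (there (here refl)) , inV u (there (there (here refl))) ,
            inV w (there (there (there (here refl))))
    bound : ∀ r → Family (BP n) (s ∷ t ∷ u ∷ w ∷ []) r → r ≤ suc m
    bound r F with ℕₚ.m≤n⇒m<n∨m≡n (degree-bound F (here refl) (there (here refl)) s≢t)
    ... | inj₁ (s≤s le) = le
    ... | inj₂ refl     = ⊥-elim (¬F F)

  -- The words `x` and `y` differ by a reversal of length 1, so the bound for adjacent vertices
  -- applies with `z` as third vertex. All four words vary only in the first two positions, which
  -- covers n = 2 as well.
  kappa-attained : Σ (List V) λ S → IsKSubset (BP n) 4 S × KappaS (BP n) S (suc m)
  kappa-attained = S , (U , refl , inV) , lower-bound m x y z w (px , py , pz , pw) U , bound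
    where
    rest : V
    rest = tabulate (λ i → unbarred (suc (suc i)))
    x y z w : V
    x = unbarred zero ∷ unbarred (suc zero) ∷ rest
    y = turn [] (unbarred zero) (unbarred (suc zero) ∷ rest)
    z = turn (unbarred zero ∷ []) (unbarred (suc zero)) rest
    w = turn [] (hd z) (drop 1 z)
    S : List V
    S = x ∷ y ∷ z ∷ w ∷ []
    px : Perm x
    px = some-perm
    py : Perm y
    py = turn-perm [] (unbarred zero) (unbarred (suc zero) ∷ rest) px
    pz : Perm z
    pz = turn-perm (unbarred zero ∷ []) (unbarred (suc zero)) rest px
    pw : Perm w
    pw = turn-perm [] (hd z) (drop 1 z) pz
    U : Unique S
    U = ((λ ()) ∷ (λ ()) ∷ (λ ()) ∷ []) ∷ ((λ ()) ∷ (λ ()) ∷ []) ∷ ((λ ()) ∷ []) ∷ [] ∷ []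
    inV : ∀ v → v ∈ S → Perm v
    inV v (here refl)                         = px
    inV v (there (here refl))                 = py
    inV v (there (there (here refl)))         = pz
    inV v (there (there (there (here refl)))) = pw
    bound : ∀ r → Family (BP n) S r → r ≤ suc m
    bound r F = adjacent-bound F (here refl) (there (here refl)) (there (there (here refl))) (λ ()) (λ ())
      {k = zero} {l = zero} refl refl refl

theorem1p1 : (n : ℕ) → 2 ≤ n → Kappa 4 (BP n) (n ∸ 1)
theorem1p1 (suc (suc m)) _ = Value.kappa-exists m , Value.kappa-attained m
theorem1p1 (suc zero) (s≤s ())
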